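{- Let $X\subseteq\mathbb{N}^2$ and suppose that for each $n$ the directed graph $G_n(X)$ is a tournament. Then \[ d_X(\emptyset;n)=\sum_{w}2^{\mathrm{nsc}(w)}, \] where the sum ranges over all $w\in\mathfrak{S}_n$ of odd order (all cycle lengths odd) such that every nontrivial cycle of $w$ is a directed cycle of $\overline{G_n(X)}$.
   Context: $[n]=\{1,\dots,n\}$. For $\pi=\pi_1\cdots\pi_n\in\mathfrak{S}_n$, $\mathrm{XDes}(\pi)=\{i\in[n-1]:(\pi_i,\pi_{i+1})\in X\}$; $d_X(\emptyset;n)$ is the number of $\pi\in\mathfrak{S}_n$ with $\mathrm{XDes}(\pi)=\emptyset$. $G_n(X)$ is the digraph on $[n]$ with an edge $i\to j$ iff $i\ne j$ and $(i,j)\notin X$. A tournament is a digraph in which for every two distinct vertices $i,j$ exactly one of $i\to j$, $j\to i$ is an edge; $\overline{D}$ is the tournament obtained from $D$ by reversing all edges. $\mathrm{nsc}(w)$ is the number of nontrivial (length $\ge2$) cycles in the disjoint cycle decomposition of $w$. A cycle $(v_1\,v_2\cdots v_k)$ of $w$ (so $w(v_i)=v_{i+1}$, indices mod $k$) is a directed cycle of a digraph $D$ if $v_i\to v_{i+1}$ is an edge of $D$ for all $i$ (indices mod $k$). -}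

module Defs where

open import Data.Nat using (ℕ; zero; suc; _≤_; _≤?_; _%_)
import Data.Nat as ℕ
open import Data.Bool using (Bool; true; false; if_then_else_)
import Data.Bool as B
open import Data.Fin using (Fin; toℕ; _≟_)
import Data.Fin
open import Data.Fin.Properties using (all?)
open import Data.Vec using (Vec; []; _∷_; lookup; toList)
open import Data.List using (List; []; _∷_; [_]; map; concatMap; filter; length; allFin)
open import Data.Product using (_×_; _,_)
open import Data.Sum using (_⊎_)
open import Data.Unit using (⊤; tt)
open import Relation.Nullary using (¬_; Dec; yes; no; does)
open import Relation.Nullary.Decidable using (¬?; _×-dec_; _→-dec_)
open import Relation.Binary.PropositionalEquality using (_≡_; _≢_)

Subset² : Set
Subset² = ℕ → ℕ → Bool

_∈X[_] : ℕ × ℕ → Subset² → Set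
(a , b) ∈X[ X ] = X a b ≡ true

-- [n] = {1,…,n} is represented by Fin n; i : Fin n stands for el i = toℕ i + 1.
el : {n : ℕ} → Fin n → ℕ
el i = suc (toℕ i)

Digraph : ℕ → Set₁
Digraph n = Fin n → Fin n → Set

G : Subset² → (n : ℕ) → Digraph n
G X n i j = (i ≢ j) × ¬ ((el i , el j) ∈X[ X ])

IsTournament : {n : ℕ} → Digraph n → Set
IsTournament {n} D = ∀ (i j : Fin n) → i ≢ j → (D i j × ¬ D j i) ⊎ (D j i × ¬ D i j)

rev : {n : ℕ} → Digraph n → Digraph n
rev D i j = D j i

-- Permutations of [n] in one-line notation: injective words π₁⋯πₙ.

allVecs : (n k : ℕ) → List (Vec (Fin n) k)
allVecs n zero = [ [] ]
allVecs n (suc k) = concatMap (λ i → map (i ∷_) (allVecs n k)) (allFin n)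

IsPerm : {n : ℕ} → Vec (Fin n) n → Set
IsPerm {n} v = ∀ (i j : Fin n) → lookup v i ≡ lookup v j → i ≡ j

isPerm? : {n : ℕ} → (v : Vec (Fin n) n) → Dec (IsPerm v)
isPerm? v = all? (λ i → all? (λ j → (lookup v i ≟ lookup v j) →-dec (i ≟ j)))

-- 𝔖_n, as a duplicate-free list of all permutations
𝔖 : (n : ℕ) → List (Vec (Fin n) n)
𝔖 n = filter isPerm? (allVecs n n)

NoXDes : Subset² → List ℕ → Set
NoXDes X [] = ⊤
NoXDes X (a ∷ []) = ⊤
NoXDes X (a ∷ b ∷ r) = ¬ ((a , b) ∈X[ X ]) × NoXDes X (b ∷ r)

noXDes? : (X : Subset²) → (xs : List ℕ) → Dec (NoXDes X xs)
noXDes? X [] = yes tt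
noXDes? X (a ∷ []) = yes tt
noXDes? X (a ∷ b ∷ r) = ¬? (X a b B.≟ true) ×-dec noXDes? X (b ∷ r)

XDesEmpty : Subset² → {n : ℕ} → Vec (Fin n) n → Set
XDesEmpty X π = NoXDes X (map el (toList π))

dX∅ : Subset² → ℕ → ℕ
dX∅ X n = length (filter (λ π → noXDes? X (map el (toList π))) (𝔖 n))

ap : {n : ℕ} → Vec (Fin n) n → Fin n → Fin n
ap w i = lookup w i

iter : {n : ℕ} → Vec (Fin n) n → ℕ → Fin n → Fin n
iter w zero i = i
iter w (suc k) i = ap w (iter w k i)

cycLenAux : {n : ℕ} → Vec (Fin n) n → Fin n → (fuel k : ℕ) → ℕ
cycLenAux w i zero k = 0
cycLenAux {n} w i (suc f) k = if does (iter w k i ≟ i) then k else cycLenAux w i f (suc k)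

cycLen : {n : ℕ} → Vec (Fin n) n → Fin n → ℕ
cycLen {n} w i = cycLenAux w i n 1

OddOrder : {n : ℕ} → Vec (Fin n) n → Set
OddOrder {n} w = ∀ (i : Fin n) → cycLen w i % 2 ≡ 1

oddOrder? : {n : ℕ} → (w : Vec (Fin n) n) → Dec (OddOrder w)
oddOrder? w = all? (λ i → (cycLen w i % 2) ℕ.≟ 1)

IsCycleMin : {n : ℕ} → Vec (Fin n) n → Fin n → Set
IsCycleMin {n} w i = ∀ (j : Fin n) → toℕ i ≤ toℕ (iter w (toℕ j) i)

-- nsc(w): number of nontrivial cycles (counted by their minimal elements)
nsc : {n : ℕ} → Vec (Fin n) n → ℕ
nsc {n} w = length (filter (λ i → ¬? (ap w i ≟ i) ×-dec all? {n} (λ j → toℕ i ≤? toℕ (iter w (toℕ j) i))) (allFin n))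

-- every nontrivial cycle (v₁ ⋯ v_k) of w is a directed cycle of D,
-- i.e. v → w(v) is an edge of D for every v lying in a nontrivial cycle
NontrivCyclesDirected : {n : ℕ} → Digraph n → Vec (Fin n) n → Set
NontrivCyclesDirected {n} D w = ∀ (v : Fin n) → ap w v ≢ v → D v (ap w v)

nontrivCyclesDirectedRevG? : (X : Subset²) → {n : ℕ} → (w : Vec (Fin n) n) →
  Dec (NontrivCyclesDirected (rev (G X n)) w)
nontrivCyclesDirectedRevG? X w =
  all? (λ v → ¬? (ap w v ≟ v) →-dec (¬? (ap w v ≟ v) ×-dec ¬? (X (el (ap w v)) (el v) B.≟ true)))

good? : (X : Subset²) → (n : ℕ) → (w : Vec (Fin n) n) →
  Dec (OddOrder w × NontrivCyclesDirected (rev (G X n)) w)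
good? X n w = oddOrder? w ×-dec nontrivCyclesDirectedRevG? X w

{-# OPTIONS --safe #-}

-- Write A for the 0/1 adjacency matrix of the tournament.  Expanding every
-- factor A(πᵢ,πᵢ₊₁) of a Hamiltonian path as 1 − B and telescoping along the
-- cycle through a fixed vertex v shows that the number of Hamiltonian paths on
-- v ∷ S is the sum, over all cycles c through v with vertices in v ∷ S, of
-- (∏ A − (−1)^|c| ∏ B) over the edges of c times the number of Hamiltonian
-- paths on the vertices off c.  For a tournament B is Aᵀ off the diagonal, so
-- reversing cycles cancels the even ones and doubles the nontrivial odd ones.
-- The weighted sum over permutations obeys the same recursion: build w cycle
-- by cycle, starting each cycle at the smallest unused vertex.
module Submission where

open import Defs
open import Algebra.Properties.CommutativeSemigroup using (interchange; x∙yz≈y∙xz)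
open import Data.Bool using (true; false; if_then_else_)
import Data.Bool as Bool
open import Data.Fin using (Fin; toℕ; fromℕ<; _≟_; punchOut)
import Data.Fin as Fin
import Data.Fin.Properties as Fin
open import Data.Fin.Permutation.Components using (transpose; transpose-inverse)
open import Data.Integer using (ℤ; 0ℤ; 1ℤ; _+_; _*_; -_; _-_) renaming (+_ to pos)
open import Data.Integer.Properties using (*-assoc; *-comm; *-distribʳ-+; *-distribˡ-+; *-identityʳ; *-identityˡ; *-zeroʳ; *-zeroˡ; +-assoc; +-comm; +-identityʳ; +-identityˡ; +-injective; pos-*; pos-+; +-commutativeSemigroup; *-commutativeSemigroup)
open import Data.Integer.Tactic.RingSolver using (solve-∀)
open import Data.List using (List; []; _∷_; _++_; map; concatMap; filter; length; allFin)
import Data.List as List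
open import Data.List.Properties using (∷-injectiveˡ)
open import Data.List.Membership.Propositional using (_∈_)
open import Data.List.Membership.Propositional.Properties using (∈-allFin; ∈-filter⁻)
import Data.List.Relation.Unary.All as ListAll
open import Data.List.Relation.Unary.AllPairs using ([]; _∷_)
open import Data.List.Relation.Unary.Any using (here; there)
import Data.List.Relation.Unary.Unique.Propositional as List
open import Data.List.Relation.Unary.Unique.Propositional.Properties using (allFin⁺)
open import Data.Nat using (ℕ; zero; suc; z<s; s<s; _<_; _≤_; _∸_; _%_; _^_)
import Data.Nat as ℕ
import Data.Nat.Properties as ℕ
open import Data.Nat.ListAction using (sum)
open import Data.Product using (∃; _×_; _,_; proj₁; proj₂; map₂)
open import Data.Sum using (_⊎_; inj₁; inj₂; [_,_]′)
open import Data.Vec using (Vec; []; _∷_; toList; tabulate)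
import Data.Vec as Vec
import Data.Vec.Properties as Vec
import Data.Vec.Membership.DecPropositional as VecDec
import Data.Vec.Membership.Propositional as Vec
import Data.Vec.Membership.Propositional.Properties as Vec
open import Data.Vec.Relation.Unary.All using (All; []; _∷_; all?)
import Data.Vec.Relation.Unary.All as All
import Data.Vec.Relation.Unary.All.Properties as All
open import Data.Vec.Relation.Unary.AllPairs using (AllPairs; []; _∷_; allPairs?)
import Data.Vec.Relation.Unary.AllPairs as AllPairs
open import Data.Vec.Relation.Unary.Any using (here; there)
open import Data.Vec.Relation.Unary.Unique.Propositional using (Unique)
import Data.Vec.Relation.Unary.Unique.Propositional.Properties as Unique
open import Function using (_∘_; id; flip; Injective)
open import Relation.Binary.PropositionalEquality using (_≡_; _≢_; refl; sym; ≢-sym; trans; cong; cong₂; subst; module ≡-Reasoning)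
open import Relation.Nullary using (¬_; Dec; yes; no; does; contradiction)
open import Relation.Nullary.Decidable using (¬?; _×-dec_; _→-dec_; dec-true; dec-false)
open ≡-Reasoning

-- The diagonal needs separate care. Without loops, the bare loop at v has weight 0 in both A and
-- its transpose, but -1 in A - 1. The trivial cycle therefore contributes 0 - (-1) = 1, which is
-- exactly the weight of a fixed point of w; only nontrivial cycles see the factor 1 - (-1)^|c|,
-- equal to 0 or 2. On the permutation side, the parity of a cycle and the place of its minimum are
-- unknown until the cycle closes. While it grows, two products are carried along, one over the
-- transpose and one over its negative; at closure their difference is the weight of the cycle.

variable
  V I J Φ Ψ : Set
  k : ℕ

+-interchange : ∀ p q r s → (p + q) + (r + s) ≡ (p + r) + (q + s)
+-interchange = interchange +-commutativeSemigroup

+-swap : ∀ p q r → p + (q + r) ≡ q + (p + r)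
+-swap = x∙yz≈y∙xz +-commutativeSemigroup

*-interchange : ∀ p q r s → (p * q) * (r * s) ≡ (p * r) * (q * s)
*-interchange = interchange *-commutativeSemigroup

*-swap : ∀ p q r → p * (q * r) ≡ q * (p * r)
*-swap = x∙yz≈y∙xz *-commutativeSemigroup

-- Weighted paths and cycles

data Pick {V : Set} (x : V) : Vec V k → Vec V (suc k) → Set where
  here  : {S : Vec V k} → Pick x S (x ∷ S)
  there : ∀ {y} {T : Vec V k} {S} → Pick x T S → Pick x (y ∷ T) (y ∷ S)

-- The vertices left over keep their order in `S`, so sortedness survives a pick.
∑pick : Vec V (suc k) → (V → Vec V k → ℤ) → ℤ
∑pick {k = zero}  (x ∷ []) f = f x []
∑pick {k = suc _} (x ∷ S)  f = f x S + ∑pick S (λ y T → f y (x ∷ T))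

∑pick-cong : (S : Vec V (suc k)) {f g : V → Vec V k → ℤ} →
  (∀ {x T} → Pick x T S → f x T ≡ g x T) → ∑pick S f ≡ ∑pick S g
∑pick-cong {k = zero}  (x ∷ []) e = e here
∑pick-cong {k = suc _} (x ∷ S)  e = cong₂ _+_ (e here) (∑pick-cong S (λ p → e (there p)))

∑pick-+ : (S : Vec V (suc k)) (f g : V → Vec V k → ℤ) →
  ∑pick S (λ x T → f x T + g x T) ≡ ∑pick S f + ∑pick S g
∑pick-+ {k = zero}  (x ∷ []) f g = refl
∑pick-+ {k = suc _} (x ∷ S)  f g =
  trans (cong (f x S + g x S +_) (∑pick-+ S f′ g′)) (+-interchange (f x S) (g x S) (∑pick S f′) (∑pick S g′))
  where
  f′ g′ : _ → _ → ℤ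
  f′ y T = f y (x ∷ T)
  g′ y T = g y (x ∷ T)

∑pick-*ˡ : (S : Vec V (suc k)) (c : ℤ) (f : V → Vec V k → ℤ) →
  ∑pick S (λ x T → c * f x T) ≡ c * ∑pick S f
∑pick-*ˡ {k = zero}  (x ∷ []) c f = refl
∑pick-*ˡ {k = suc _} (x ∷ S)  c f =
  trans (cong (c * f x S +_) (∑pick-*ˡ S c _)) (sym (*-distribˡ-+ c _ _))

∑pick-*ʳ : (S : Vec V (suc k)) (c : ℤ) (f : V → Vec V k → ℤ) →
  ∑pick S (λ x T → f x T * c) ≡ ∑pick S f * c
∑pick-*ʳ S c f =
  trans (∑pick-cong S (λ _ → *-comm _ c)) (trans (∑pick-*ˡ S c f) (*-comm c _))

∑pick-- : (S : Vec V (suc k)) (f g : V → Vec V k → ℤ) →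
  ∑pick S (λ x T → f x T - g x T) ≡ ∑pick S f - ∑pick S g
∑pick-- {k = zero}  (x ∷ []) f g = refl
∑pick-- {k = suc _} (x ∷ S)  f g =
  trans (cong (f x S - g x S +_) (∑pick-- S f′ g′)) (lem (f x S) (g x S) (∑pick S f′) (∑pick S g′))
  where
  f′ g′ : _ → _ → ℤ
  f′ y T = f y (x ∷ T)
  g′ y T = g y (x ∷ T)
  lem : ∀ a b c d → a - b + (c - d) ≡ a + c - (b + d)
  lem = solve-∀

-- Two positions removed in either order leave the same vector, so the two choices can be exchanged.
∑pick-comm : (S : Vec V (suc (suc k))) (f : V → V → Vec V k → ℤ) →
  ∑pick S (λ x T → ∑pick T (λ y U → f x y U)) ≡ ∑pick S (λ x T → ∑pick T (λ y U → f y x U))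
∑pick-comm {k = zero}  (x ∷ y ∷ []) f = +-comm (f x y []) (f y x [])
∑pick-comm {k = suc _} (x ∷ S)      f = begin
  ∑pick S (f x) + ∑pick S (λ y T → f y x T + ∑pick T (λ z U → f y z (x ∷ U)))
    ≡⟨ cong (∑pick S (f x) +_) (∑pick-+ S _ _) ⟩
  ∑pick S (f x) + (∑pick S (λ y → f y x) + ∑pick S (λ y T → ∑pick T (λ z U → f y z (x ∷ U))))
    ≡⟨ cong (λ s → ∑pick S (f x) + (∑pick S (λ y → f y x) + s)) (∑pick-comm S (λ y z U → f y z (x ∷ U))) ⟩
  ∑pick S (f x) + (∑pick S (λ y → f y x) + ∑pick S (λ y T → ∑pick T (λ z U → f z y (x ∷ U))))
    ≡⟨ +-swap (∑pick S (f x)) (∑pick S (λ y → f y x)) (∑pick S (λ y T → ∑pick T (λ z U → f z y (x ∷ U)))) ⟩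
  ∑pick S (λ y → f y x) + (∑pick S (f x) + ∑pick S (λ y T → ∑pick T (λ z U → f z y (x ∷ U))))
    ≡⟨ cong (∑pick S (λ y → f y x) +_) (∑pick-+ S _ _) ⟨
  ∑pick S (λ y → f y x) + ∑pick S (λ y T → f x y T + ∑pick T (λ z U → f z y (x ∷ U))) ∎

Weight : Set → Set
Weight V = ∀ {j} → Vec V j → ℤ

hamFrom : (V → V → ℤ) → V → Weight V
hamFrom A a {zero}  S = 1ℤ
hamFrom A a {suc _} S = ∑pick S (λ x T → A a x * hamFrom A x T)

ham : (V → V → ℤ) → Weight V
ham A {zero}  S = 1ℤ
ham A {suc _} S = ∑pick S (λ x T → hamFrom A x T)

-- walks M h b a S sums, over the walks a → x₁ → ⋯ → xᵢ → b (i ≥ 0) with distinct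
-- xⱼ picked from S, the product of the M-weights of the edges times the value
-- of h on the unpicked vertices.
walks : (V → V → ℤ) → Weight V → V → V → Weight V
walks M h b a {zero}  S = M a b * h S
walks M h b a {suc _} S = M a b * h S + ∑pick S (λ x T → M a x * walks M h b x T)

-- The recursion of `walks` removes the first edge. Exchanging the choices of the first and the last
-- inner vertex lets the last edge be removed instead, which is what reversal requires.
walks-peelʳ : ∀ (M : V → V → ℤ) (h : Weight V) b a (S : Vec V (suc k)) →
  walks M h b a S ≡ M a b * h S + ∑pick S (λ x T → M x b * walks M h x a T)
walks-peelʳ {k = zero}  M h b a (x ∷ []) = cong (M a b * h (x ∷ []) +_) (*-swap (M a x) (M x b) (h []))
walks-peelʳ {k = suc _} M h b a S = cong (M a b * h S +_) (begin
  ∑pick S (λ x T → M a x * walks M h b x T)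
    ≡⟨ ∑pick-cong S (λ {x} {T} _ → cong (M a x *_) (walks-peelʳ M h b x T)) ⟩
  ∑pick S (λ x T → M a x * (M x b * h T + ∑pick T (λ y U → M y b * walks M h y x U)))
    ≡⟨ ∑pick-cong S (λ {x} {T} _ → expand (M a x) (M x b) (h T) T _) ⟩
  ∑pick S (λ x T → M x b * (M a x * h T) + ∑pick T (λ y U → M a x * (M y b * walks M h y x U)))
    ≡⟨ ∑pick-+ S _ _ ⟩
  ∑pick S (λ x T → M x b * (M a x * h T)) +
  ∑pick S (λ x T → ∑pick T (λ y U → M a x * (M y b * walks M h y x U)))
    ≡⟨ cong (∑pick S (λ x T → M x b * (M a x * h T)) +_) (∑pick-comm S _) ⟩
  ∑pick S (λ x T → M x b * (M a x * h T)) +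
  ∑pick S (λ x T → ∑pick T (λ y U → M a y * (M x b * walks M h x y U)))
    ≡⟨ ∑pick-+ S _ _ ⟨
  ∑pick S (λ x T → M x b * (M a x * h T) + ∑pick T (λ y U → M a y * (M x b * walks M h x y U)))
    ≡⟨ ∑pick-cong S (λ {x} {T} _ → collect (M x b) (M a x * h T) T (M a) (λ y U → walks M h x y U)) ⟩
  ∑pick S (λ x T → M x b * (M a x * h T + ∑pick T (λ y U → M a y * walks M h x y U))) ∎)
  where
  expand : ∀ p q r (T : Vec _ _) f →
    p * (q * r + ∑pick T f) ≡ q * (p * r) + ∑pick T (λ y U → p * f y U)
  expand p q r T f = trans (*-distribˡ-+ p _ _) (cong₂ _+_ (*-swap p q r) (sym (∑pick-*ˡ T p f)))
  collect : ∀ q r (T : Vec _ _) (c : _ → ℤ) (f : _ → Vec _ _ → ℤ) →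
    q * r + ∑pick T (λ y U → c y * (q * f y U)) ≡ q * (r + ∑pick T (λ y U → c y * f y U))
  collect q r T c f = trans
    (cong (q * r +_) (trans (∑pick-cong T (λ {y} {U} _ → *-swap (c y) q (f y U))) (∑pick-*ˡ T q _)))
    (sym (*-distribˡ-+ q r _))

walks-reverse : ∀ (M : V → V → ℤ) (h : Weight V) b a (S : Vec V k) →
  walks M h b a S ≡ walks (flip M) h a b S
walks-reverse {k = zero}  M h b a S = refl
walks-reverse {k = suc _} M h b a S = trans
  (cong (M a b * h S +_) (∑pick-cong S (λ {x} {T} _ → cong (M a x *_) (walks-reverse M h b x T))))
  (sym (walks-peelʳ (flip M) h a b S))

-- The cycle recursion for Hamiltonian paths of an arbitrary matrix

module _ (A : V → V → ℤ) where

  -- This is -B for the complement B = 1 - A, so a product over the edges of a cycle already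
  -- contains the sign (-1)^|c|.
  A-1 : V → V → ℤ
  A-1 a b = A a b - 1ℤ

  -- In `A a x` = 1 + `A-1 a x` the 1 forgets the edge out of `a` and leaves a free Hamiltonian path
  -- on `S`.
  hamFrom-complement : ∀ a (S : Vec V (suc k)) →
    hamFrom A a S ≡ ham A S + ∑pick S (λ x T → A-1 a x * hamFrom A x T)
  hamFrom-complement a S = begin
    ∑pick S (λ x T → A a x * hamFrom A x T)
      ≡⟨ ∑pick-cong S (λ {x} {T} _ → lem (A a x) (hamFrom A x T)) ⟩
    ∑pick S (λ x T → hamFrom A x T + A-1 a x * hamFrom A x T)
      ≡⟨ ∑pick-+ S _ _ ⟩
    ham A S + ∑pick S (λ x T → A-1 a x * hamFrom A x T) ∎
    where
    lem : ∀ p q → p * q ≡ q + (p - 1ℤ) * q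
    lem = solve-∀

  -- The path is cut at `v`: a walk into `v`, then a path from `v` through the vertices not yet
  -- visited. Since `∑pick` lists the head first, the case that `v` comes next is the direct edge of
  -- `walks`.
  hamFrom-cons : ∀ v y (T : Vec V k) → hamFrom A y (v ∷ T) ≡ walks A (hamFrom A v) v y T
  hamFrom-cons {k = zero}  v y []  = refl
  hamFrom-cons {k = suc _} v y T =
    cong (A y v * hamFrom A v T +_)
      (∑pick-cong T (λ {x} {U} _ → cong (A y x *_) (hamFrom-cons v x U)))

  -- The expansion of the edge out of `a`, carried out on the path that uses up what the walk leaves
  -- over. Its next vertex `b` is chosen after the inner vertices of the walk, so the choice has to
  -- be commuted to the front.
  walks-complement : ∀ v a x (T : Vec V (suc k)) →
    walks A (hamFrom A a) v x T ≡
    walks A (ham A) v x T + ∑pick T (λ b U → A-1 a b * walks A (hamFrom A b) v x U)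
  walks-complement {k = k} v a x T = begin
    A x v * hamFrom A a T + ∑pick T (λ y U → A x y * walks A (hamFrom A a) v y U)
      ≡⟨ cong₂ (λ p q → A x v * p + q) (hamFrom-complement a T) (step T) ⟩
    A x v * (ham A T + ∑pick T (λ b U → A-1 a b * hamFrom A b U)) + (P + ∑pick T (tails k))
      ≡⟨ lem₁ (A x v) (ham A T) _ P _ ⟩
    A x v * ham A T + P +
      (A x v * ∑pick T (λ b U → A-1 a b * hamFrom A b U) + ∑pick T (tails k))
      ≡⟨ cong (λ s → A x v * ham A T + P + (s + ∑pick T (tails k))) (∑pick-*ˡ T (A x v) _) ⟨
    A x v * ham A T + P +
      (∑pick T (λ b U → A x v * (A-1 a b * hamFrom A b U)) + ∑pick T (tails k))
      ≡⟨ cong (A x v * ham A T + P +_) (∑pick-+ T _ _) ⟨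
    A x v * ham A T + P +
      ∑pick T (λ b U → A x v * (A-1 a b * hamFrom A b U) + tails k b U)
      ≡⟨ cong (A x v * ham A T + P +_) (∑pick-cong T (λ {b} {U} _ → merge k b U)) ⟩
    A x v * ham A T + P + ∑pick T (λ b U → A-1 a b * walks A (hamFrom A b) v x U) ∎
    where
    P = ∑pick T (λ y U → A x y * walks A (ham A) v y U)
    tails : ∀ k → V → Vec V k → ℤ
    -- Once `b` is taken nothing remains, so the walk from `x` to `v` has no inner vertex.
    tails zero    b U = 0ℤ
    tails (suc k) b U = ∑pick U (λ y W → A x y * (A-1 a b * walks A (hamFrom A b) v y W))
    lem₁ : ∀ p h s q t → p * (h + s) + (q + t) ≡ p * h + q + (p * s + t)
    lem₁ = solve-∀
    merge : ∀ k b (U : Vec V k) →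
      A x v * (A-1 a b * hamFrom A b U) + tails k b U ≡ A-1 a b * walks A (hamFrom A b) v x U
    merge zero    b U = trans (+-identityʳ _) (*-swap (A x v) (A-1 a b) (hamFrom A b U))
    merge (suc k) b U = trans
      (cong₂ _+_ (*-swap (A x v) (A-1 a b) (hamFrom A b U))
        (trans (∑pick-cong U (λ {y} {W} _ → *-swap (A x y) (A-1 a b) (walks A (hamFrom A b) v y W))) (∑pick-*ˡ U (A-1 a b) _)))
      (sym (*-distribˡ-+ (A-1 a b) _ _))
    step : ∀ {k} (T : Vec V (suc k)) →
      ∑pick T (λ y U → A x y * walks A (hamFrom A a) v y U) ≡
      ∑pick T (λ y U → A x y * walks A (ham A) v y U) + ∑pick T (tails k)
    -- The walk uses the only vertex; on the empty rest `hamFrom` and `ham` are both 1, so there is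
    -- no correction.
    step {zero}  (y ∷ []) = sym (+-identityʳ _)
    step {suc k} T = begin
      ∑pick T (λ y U → A x y * walks A (hamFrom A a) v y U)
        ≡⟨ ∑pick-cong T (λ {y} {U} _ → trans
             (cong (A x y *_) (walks-complement v a y U))
             (trans (*-distribˡ-+ (A x y) _ _) (cong (A x y * walks A (ham A) v y U +_) (sym (∑pick-*ˡ U (A x y) _))))) ⟩
      ∑pick T (λ y U → A x y * walks A (ham A) v y U +
                       ∑pick U (λ b W → A x y * (A-1 a b * walks A (hamFrom A b) v y W)))
        ≡⟨ ∑pick-+ T _ _ ⟩
      ∑pick T (λ y U → A x y * walks A (ham A) v y U) +
      ∑pick T (λ y U → ∑pick U (λ b W → A x y * (A-1 a b * walks A (hamFrom A b) v y W)))
        ≡⟨ cong (∑pick T (λ y U → A x y * walks A (ham A) v y U) +_) (∑pick-comm T _) ⟩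
      ∑pick T (λ y U → A x y * walks A (ham A) v y U) + ∑pick T (tails (suc k)) ∎

  -- For a = v these are the Hamiltonian paths on v ∷ S, cut at v.  Letting the
  -- part after v start at an arbitrary a makes the telescoping an induction.
  hamThrough : V → V → Weight V
  hamThrough v a {zero}  S = hamFrom A a S
  hamThrough v a {suc _} S = hamFrom A a S + ∑pick S (λ x T → walks A (hamFrom A a) v x T)

  private
    W : V → V → Weight V
    W v a S = walks A (ham A) v a S

  -- Expanding the edge out of `a` either detaches `a`, leaving a free path on `S` or a walk into
  -- `v` beside a free path, or moves `a` on to `x` at the price `A-1 a x`.
  hamThrough-complement : ∀ v a (S : Vec V (suc k)) →
    hamThrough v a S ≡
    ham A S + ∑pick S (λ x T → W v x T) + ∑pick S (λ x T → A-1 a x * hamThrough v x T)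
  hamThrough-complement {k = zero} v a (x ∷ []) = begin
    hamFrom A a (x ∷ []) + W v x []
      ≡⟨ cong (_+ W v x []) (hamFrom-complement a (x ∷ [])) ⟩
    ham A (x ∷ []) + A-1 a x * hamFrom A x [] + W v x []
      ≡⟨ swapʳ (ham A (x ∷ [])) (A-1 a x * hamFrom A x []) (W v x []) ⟩
    ham A (x ∷ []) + W v x [] + A-1 a x * hamFrom A x [] ∎
    where
    swapʳ : ∀ p q r → p + q + r ≡ p + r + q
    swapʳ = solve-∀
  hamThrough-complement {k = suc _} v a S = begin
    hamFrom A a S + ∑pick S (λ x T → walks A (hamFrom A a) v x T)
      ≡⟨ cong₂ _+_ (hamFrom-complement a S)
           (trans (∑pick-cong S (λ {x} {T} _ → walks-complement v a x T)) (∑pick-+ S _ _)) ⟩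
    ham A S + P + (Q + ∑pick S (λ x T → ∑pick T (λ b U → A-1 a b * walks A (hamFrom A b) v x U)))
      ≡⟨ cong (λ s → ham A S + P + (Q + s)) (trans (∑pick-comm S _)
           (∑pick-cong S (λ {b} {T} _ → ∑pick-*ˡ T (A-1 a b) _))) ⟩
    ham A S + P + (Q + R)
      ≡⟨ +-interchange (ham A S) P Q R ⟩
    ham A S + Q + (P + R)
      ≡⟨ cong (ham A S + Q +_) (trans (sym (∑pick-+ S _ _))
           (∑pick-cong S (λ {b} {T} _ → sym (*-distribˡ-+ (A-1 a b) (hamFrom A b T) _)))) ⟩
    ham A S + Q + ∑pick S (λ b T → A-1 a b * hamThrough v b T) ∎
    where
    P = ∑pick S (λ b T → A-1 a b * hamFrom A b T)
    Q = ∑pick S (λ x T → W v x T)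
    R = ∑pick S (λ b T → A-1 a b * ∑pick T (λ x U → walks A (hamFrom A b) v x U))

  -- The telescoping: the `W v x T` from the detached terms joins `A-1 a x` times the `W v x T` of
  -- the induction hypothesis to give `A a x * W v x T`, a longer walk.
  hamThrough-walks : ∀ v a (S : Vec V k) →
    hamThrough v a S ≡ W v a S - walks A-1 (ham A) v a S
  hamThrough-walks {k = zero} v a S = lem (A a v)
    where
    lem : ∀ p → 1ℤ ≡ p * 1ℤ - (p - 1ℤ) * 1ℤ
    lem = solve-∀
  hamThrough-walks {k = suc _} v a S = begin
    hamThrough v a S
      ≡⟨ hamThrough-complement v a S ⟩
    ham A S + ∑pick S (λ x T → W v x T) + ∑pick S (λ x T → A-1 a x * hamThrough v x T)
      ≡⟨ trans (+-assoc (ham A S) _ _) (cong (ham A S +_) (sym (∑pick-+ S _ _))) ⟩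
    ham A S + ∑pick S (λ x T → W v x T + A-1 a x * hamThrough v x T)
      ≡⟨ cong (ham A S +_) (∑pick-cong S (λ {x} {T} _ → trans
           (cong (λ z → W v x T + A-1 a x * z) (hamThrough-walks v x T))
           (lem₁ (A a x) (W v x T) (walks A-1 (ham A) v x T)))) ⟩
    ham A S + ∑pick S (λ x T → A a x * W v x T - A-1 a x * walks A-1 (ham A) v x T)
      ≡⟨ cong (ham A S +_) (∑pick-- S (λ x T → A a x * W v x T) (λ x T → A-1 a x * walks A-1 (ham A) v x T)) ⟩
    ham A S + (P - Q)
      -- The lone `ham A S` is the difference of its multiples by `A a v` and `A-1 a v`, the direct
      -- edges from `a` to `v` of the two walks.
      ≡⟨ lem₂ (A a v) (ham A S) P Q ⟩
    (A a v * ham A S + P) - (A-1 a v * ham A S + Q) ∎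
    where
    P = ∑pick S (λ x T → A a x * W v x T)
    Q = ∑pick S (λ x T → A-1 a x * walks A-1 (ham A) v x T)
    lem₁ : ∀ p s t → s + (p - 1ℤ) * (s - t) ≡ p * s - (p - 1ℤ) * t
    lem₁ = solve-∀
    lem₂ : ∀ p h s t → h + (s - t) ≡ (p * h + s) - ((p - 1ℤ) * h + t)
    lem₂ = solve-∀

  -- Either `v` starts the path or it is reached from some start `x`; together these are
  -- `hamThrough` at `a = v`. The walks from `v` back to `v` are the cycles through `v`, the bare
  -- loop included.
  ham-cons : ∀ v (S : Vec V k) →
    ham A (v ∷ S) ≡ walks A (ham A) v v S - walks A-1 (ham A) v v S
  ham-cons {k = zero}  v [] = hamThrough-walks v v []
  ham-cons {k = suc _} v S  = trans
    (cong (hamFrom A v S +_) (∑pick-cong S (λ {x} {T} _ → hamFrom-cons v x T)))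
    (hamThrough-walks v v S)

-- Specialisation to tournaments

Pick-All : ∀ {P : V → Set} {x} {T : Vec V k} {S} → Pick x T S → All P S → P x × All P T
Pick-All here      (px ∷ pS) = px , pS
Pick-All (there p) (py ∷ pS) = map₂ (py ∷_) (Pick-All p pS)

Pick-AllPairs : ∀ {R : V → V → Set} {x} {T : Vec V k} {S} → Pick x T S → AllPairs R S → AllPairs R T
Pick-AllPairs here      (_ ∷ rS)  = rS
Pick-AllPairs (there p) (ry ∷ rS) = proj₂ (Pick-All p ry) ∷ Pick-AllPairs p rS

Pick-Unique : ∀ {x : V} {T : Vec V k} {S} → Pick x T S → Unique S → Unique (x ∷ T)
Pick-Unique here      u        = u
Pick-Unique (there p) (y∉ ∷ u) with Pick-All p y∉ | Pick-Unique p u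
... | y≢x , y∉T | x∉T ∷ uT = (≢-sym y≢x ∷ x∉T) ∷ (y∉T ∷ uT)

-- Unlike `walks-cong`, this allows `a = b`: once an inner vertex is picked no diagonal entry is
-- read, so agreement off the diagonal also settles closed walks, up to the bare loop.
∑pick-walks-cong : ∀ {M N : V → V → ℤ} (h : Weight V) → (∀ {x y} → x ≢ y → M x y ≡ N x y) →
  ∀ b a (S : Vec V (suc k)) → Unique (b ∷ S) → Unique (a ∷ S) →
  ∑pick S (λ x T → M a x * walks M h b x T) ≡ ∑pick S (λ x T → N a x * walks N h b x T)
walks-cong : ∀ {M N : V → V → ℤ} (h : Weight V) → (∀ {x y} → x ≢ y → M x y ≡ N x y) →
  ∀ b a (S : Vec V k) → a ≢ b → Unique (b ∷ S) → Unique (a ∷ S) → walks M h b a S ≡ walks N h b a S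
walks-cong {k = zero}  h M≈N b a S a≢b _  _  = cong (_* h S) (M≈N a≢b)
walks-cong {k = suc _} h M≈N b a S a≢b bS aS =
  cong₂ _+_ (cong (_* h S) (M≈N a≢b)) (∑pick-walks-cong h M≈N b a S bS aS)
∑pick-walks-cong h M≈N b a S (b∉S ∷ uS) (a∉S ∷ _) = ∑pick-cong S (λ {x} {T} p →
  let b≢x , b∉T = Pick-All p b∉S
  in cong₂ _*_ (M≈N (proj₁ (Pick-All p a∉S)))
       (walks-cong h M≈N b x T (≢-sym b≢x) (b∉T ∷ Pick-AllPairs p uS) (Pick-Unique p uS)))

neg : (V → V → ℤ) → V → V → ℤ
neg M a b = - M a b

module _ (A : V → V → ℤ) (loopless : ∀ x → A x x ≡ 0ℤ)
         (tournament : ∀ {x y} → x ≢ y → A x y + A y x ≡ 1ℤ) where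

  private
    h : Weight V
    h = ham A

    A-1≈-Aᵀ : ∀ {x y} → x ≢ y → A x y - 1ℤ ≡ - A y x
    A-1≈-Aᵀ {x} {y} x≢y = trans (cong (λ z → A x y - z) (sym (tournament x≢y))) (lem (A x y) (A y x))
      where
      lem : ∀ p q → p - (p + q) ≡ - q
      lem = solve-∀

    -- The diagonal of `A-1 A` is -1 and that of `neg (flip A)` is 0, so the bare loop accounts for
    -- the extra `h S`.
    walks-complement-loop : ∀ v (S : Vec V k) → Unique (v ∷ S) →
      walks (A-1 A) h v v S ≡ walks (neg (flip A)) h v v S - h S
    walks-complement-loop {k = zero} v S u =
      trans (cong (λ z → (z - 1ℤ) * 1ℤ) (loopless v)) (sym (cong (λ z → (- z) * 1ℤ - 1ℤ) (loopless v)))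
    walks-complement-loop {k = suc _} v S u = trans
      (cong₂ (λ z s → (z - 1ℤ) * h S + s) (loopless v)
        (∑pick-walks-cong h A-1≈-Aᵀ v v S u u))
      (trans (lem (h S) Q) (sym (cong (λ z → (- z) * h S + Q - h S) (loopless v))))
      where
      Q = ∑pick S (λ x T → neg (flip A) v x * walks (neg (flip A)) h v x T)
      lem : ∀ p s → (0ℤ - 1ℤ) * p + s ≡ (- 0ℤ) * p + s - p
      lem = solve-∀

  -- Only the positive term is reversed, so both terms range over the same cycles of the reversed
  -- tournament, and a cycle of length ℓ gets the coefficient 1 - (-1)^ℓ. The separate `ham A S`
  -- corresponds to `v` being fixed.
  ham-cons-tournament : ∀ v (S : Vec V k) → Unique (v ∷ S) →
    ham A (v ∷ S) ≡ ham A S + (walks (flip A) h v v S - walks (neg (flip A)) h v v S)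
  ham-cons-tournament v S u = begin
    ham A (v ∷ S)
      ≡⟨ ham-cons A v S ⟩
    walks A h v v S - walks (A-1 A) h v v S
      ≡⟨ cong₂ _-_ (walks-reverse A h v v S) (walks-complement-loop v S u) ⟩
    walks (flip A) h v v S - (walks (neg (flip A)) h v v S - h S)
      ≡⟨ lem (walks (flip A) h v v S) (walks (neg (flip A)) h v v S) (h S) ⟩
    h S + (walks (flip A) h v v S - walks (neg (flip A)) h v v S) ∎
    where
    lem : ∀ p q r → p - (q - r) ≡ r + (p - q)
    lem = solve-∀

-- Finite sums and indicators

𝟙 : Dec Φ → ℤ
𝟙 d = if does d then 1ℤ else 0ℤ

𝟙-yes : (d : Dec Φ) → Φ → 𝟙 d ≡ 1ℤ
𝟙-yes d p = cong (if_then 1ℤ else 0ℤ) (dec-true d p)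

𝟙-no : (d : Dec Φ) → ¬ Φ → 𝟙 d ≡ 0ℤ
𝟙-no d ¬p = cong (if_then 1ℤ else 0ℤ) (dec-false d ¬p)

𝟙-cong : (d : Dec Φ) (e : Dec Ψ) → (Φ → Ψ) → (Ψ → Φ) → 𝟙 d ≡ 𝟙 e
𝟙-cong (yes p) e f g = sym (𝟙-yes e (f p))
𝟙-cong (no ¬p) e f g = sym (𝟙-no e (¬p ∘ g))

𝟙-× : (d : Dec Φ) (e : Dec Ψ) → 𝟙 (d ×-dec e) ≡ 𝟙 d * 𝟙 e
𝟙-× (yes _) (yes _) = refl
𝟙-× (yes _) (no _)  = refl
𝟙-× (no _)  e       = sym (*-zeroˡ (𝟙 e))

𝟙-*-cong : (d : Dec Φ) {x y : ℤ} → (Φ → x ≡ y) → 𝟙 d * x ≡ 𝟙 d * y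
𝟙-*-cong (yes p) e = cong (1ℤ *_) (e p)
𝟙-*-cong (no _) {x} {y} e = trans (*-zeroˡ x) (sym (*-zeroˡ y))

𝟙-absorb : (d : Dec Φ) {x : ℤ} → (¬ Φ → x ≡ 0ℤ) → x ≡ 𝟙 d * x
𝟙-absorb (yes _) {x} _ = sym (*-identityˡ x)
𝟙-absorb (no ¬p) {x} e = trans (e ¬p) (sym (*-zeroˡ x))

∑ : List I → (I → ℤ) → ℤ
∑ []       f = 0ℤ
∑ (x ∷ xs) f = f x + ∑ xs f

∑-cong : (xs : List I) {f g : I → ℤ} → (∀ {x} → x ∈ xs → f x ≡ g x) → ∑ xs f ≡ ∑ xs g
∑-cong []       e = refl
∑-cong (x ∷ xs) e = cong₂ _+_ (e (here refl)) (∑-cong xs (e ∘ there))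

∑-+ : (xs : List I) (f g : I → ℤ) → ∑ xs (λ x → f x + g x) ≡ ∑ xs f + ∑ xs g
∑-+ []       f g = refl
∑-+ (x ∷ xs) f g = trans (cong (f x + g x +_) (∑-+ xs f g)) (+-interchange (f x) (g x) (∑ xs f) (∑ xs g))

∑-*ˡ : (xs : List I) (c : ℤ) (f : I → ℤ) → ∑ xs (λ x → c * f x) ≡ c * ∑ xs f
∑-*ˡ []       c f = sym (*-zeroʳ c)
∑-*ˡ (x ∷ xs) c f = trans (cong (c * f x +_) (∑-*ˡ xs c f)) (sym (*-distribˡ-+ c (f x) _))

∑-++ : (xs ys : List I) (f : I → ℤ) → ∑ (xs ++ ys) f ≡ ∑ xs f + ∑ ys f
∑-++ []       ys f = sym (+-identityˡ _)
∑-++ (x ∷ xs) ys f = trans (cong (f x +_) (∑-++ xs ys f)) (sym (+-assoc (f x) _ _))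

∑-map : (g : J → I) (xs : List J) (f : I → ℤ) → ∑ (map g xs) f ≡ ∑ xs (f ∘ g)
∑-map g []       f = refl
∑-map g (x ∷ xs) f = cong (f (g x) +_) (∑-map g xs f)

∑-concatMap : (g : J → List I) (xs : List J) (f : I → ℤ) →
  ∑ (concatMap g xs) f ≡ ∑ xs (λ x → ∑ (g x) f)
∑-concatMap g []       f = refl
∑-concatMap g (x ∷ xs) f = trans (∑-++ (g x) _ f) (cong (∑ (g x) f +_) (∑-concatMap g xs f))

∑-filter : {P : I → Set} (P? : ∀ x → Dec (P x)) (xs : List I) (f : I → ℤ) →
  ∑ (filter P? xs) f ≡ ∑ xs (λ x → 𝟙 (P? x) * f x)
∑-filter P? []       f = refl
∑-filter P? (x ∷ xs) f with does (P? x)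
... | true  = cong₂ _+_ (sym (*-identityˡ (f x))) (∑-filter P? xs f)
... | false = trans (∑-filter P? xs f)
                (sym (trans (cong (_+ ∑ xs (λ x → 𝟙 (P? x) * f x)) (*-zeroˡ (f x))) (+-identityˡ _)))

length-∑ : (xs : List I) → pos (length xs) ≡ ∑ xs (λ _ → 1ℤ)
length-∑ []       = refl
length-∑ (x ∷ xs) = cong (_+_ 1ℤ) (length-∑ xs)

pos-sum : (f : I → ℕ) (xs : List I) → pos (sum (map f xs)) ≡ ∑ xs (λ x → pos (f x))
pos-sum f []       = refl
pos-sum f (x ∷ xs) = trans (pos-+ (f x) _) (cong (pos (f x) +_) (pos-sum f xs))

∑-∑pick : (xs : List I) (S : Vec V (suc k)) (f : I → V → Vec V k → ℤ) →
  ∑ xs (λ i → ∑pick S (f i)) ≡ ∑pick S (λ x T → ∑ xs (λ i → f i x T))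
∑-∑pick xs (x ∷ [])    f = refl
∑-∑pick xs (x ∷ S@(_ ∷ _)) f = trans (∑-+ xs _ _)
  (cong (∑ xs (λ i → f i x S) +_) (∑-∑pick xs S (λ i y T → f i y (x ∷ T))))

∑-0 : (xs : List I) {f : I → ℤ} → (∀ {x} → x ∈ xs → f x ≡ 0ℤ) → ∑ xs f ≡ 0ℤ
∑-0 []       e = refl
∑-0 (x ∷ xs) e = cong₂ _+_ (e (here refl)) (∑-0 xs (e ∘ there))

_∈?_ : ∀ {n} (x : Fin n) (S : Vec (Fin n) k) → Dec (x Vec.∈ S)
x ∈? S = VecDec._∈?_ _≟_ x S

module _ {n : ℕ} where

  ∑-delta : {xs : List (Fin n)} → List.Unique xs → ∀ {y} → y ∈ xs → (f : Fin n → ℤ) →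
    ∑ xs (λ x → 𝟙 (x ≟ y) * f x) ≡ f y
  ∑-delta {xs = y ∷ xs} (y∉ ∷ _) (here refl) f = begin
    𝟙 (y ≟ y) * f y + ∑ xs (λ x → 𝟙 (x ≟ y) * f x)
      ≡⟨ cong₂ (λ p q → p * f y + q) (𝟙-yes (y ≟ y) refl)
           (∑-0 xs (λ {x} x∈ → trans (cong (_* f x) (𝟙-no (x ≟ y) (≢-sym (ListAll.lookup y∉ x∈)))) (*-zeroˡ (f x)))) ⟩
    1ℤ * f y + 0ℤ
      ≡⟨ trans (+-identityʳ _) (*-identityˡ (f y)) ⟩
    f y ∎
  ∑-delta {xs = x ∷ xs} (x∉ ∷ u) {y} (there y∈) f = begin
    𝟙 (x ≟ y) * f x + ∑ xs (λ x → 𝟙 (x ≟ y) * f x)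
      ≡⟨ cong₂ (λ p q → p * f x + q) (𝟙-no (x ≟ y) (ListAll.lookup x∉ y∈)) (∑-delta u y∈ f) ⟩
    0ℤ * f x + f y
      ≡⟨ trans (cong (_+ f y) (*-zeroˡ (f x))) (+-identityˡ (f y)) ⟩
    f y ∎

  ∑-allFin-delta : ∀ y (f : Fin n → ℤ) → ∑ (allFin n) (λ x → 𝟙 (x ≟ y) * f x) ≡ f y
  ∑-allFin-delta y = ∑-delta (allFin⁺ n) (∈-allFin y)

  𝟙-∈-∷ : ∀ x y (S : Vec (Fin n) k) → All (y ≢_) S →
    𝟙 (x ∈? (y ∷ S)) ≡ 𝟙 (x ≟ y) + 𝟙 (x ∈? S)
  𝟙-∈-∷ x y S y∉S with x ≟ y | x ∈? S
  ... | yes refl | yes x∈S = contradiction refl (All.lookup y∉S x∈S)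
  ... | yes _    | no _    = refl
  ... | no _     | yes _   = refl
  ... | no _     | no _    = refl

  ∑pick-∑ : (S : Vec (Fin n) (suc k)) → Unique S → (f : Fin n → ℤ) →
    ∑pick S (λ x _ → f x) ≡ ∑ (allFin n) (λ x → 𝟙 (x ∈? S) * f x)
  ∑pick-∑ (y ∷ []) u f = sym (trans
    (∑-cong (allFin n) (λ {x} _ → cong (_* f x) (trans (𝟙-∈-∷ x y [] []) (+-identityʳ (𝟙 (x ≟ y))))))
    (∑-allFin-delta y f))
  ∑pick-∑ (y ∷ S@(_ ∷ _)) (y∉S ∷ u) f = begin
    f y + ∑pick S (λ x _ → f x)
      ≡⟨ cong₂ _+_ (sym (∑-allFin-delta y f)) (∑pick-∑ S u f) ⟩
    ∑ (allFin n) (λ x → 𝟙 (x ≟ y) * f x) + ∑ (allFin n) (λ x → 𝟙 (x ∈? S) * f x)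
      ≡⟨ ∑-+ (allFin n) _ _ ⟨
    ∑ (allFin n) (λ x → 𝟙 (x ≟ y) * f x + 𝟙 (x ∈? S) * f x)
      ≡⟨ ∑-cong (allFin n) (λ {x} _ → trans (sym (*-distribʳ-+ (f x) (𝟙 (x ≟ y)) (𝟙 (x ∈? S))))
           (cong (_* f x) (sym (𝟙-∈-∷ x y S y∉S)))) ⟩
    ∑ (allFin n) (λ x → 𝟙 (x ∈? (y ∷ S)) * f x) ∎

-- Arrangements of a vertex set and the enumeration of permutations

Pick-∈ : ∀ {x : V} {T : Vec V k} {S} → Pick x T S → x Vec.∈ S
Pick-∈ here      = here refl
Pick-∈ (there p) = there (Pick-∈ p)

Pick-∈⁺ : ∀ {x y : V} {T : Vec V k} {S} → Pick x T S → y Vec.∈ T → y Vec.∈ S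
Pick-∈⁺ here      y∈          = there y∈
Pick-∈⁺ (there p) (here y≡)   = here y≡
Pick-∈⁺ (there p) (there y∈)  = there (Pick-∈⁺ p y∈)

Pick-∈⁻ : ∀ {x y : V} {T : Vec V k} {S} → Pick x T S → y Vec.∈ S → y ≡ x ⊎ y Vec.∈ T
Pick-∈⁻ here      (here y≡x)  = inj₁ y≡x
Pick-∈⁻ here      (there y∈)  = inj₂ y∈
Pick-∈⁻ (there p) (here y≡)   = inj₂ (here y≡)
Pick-∈⁻ (there p) (there y∈) with Pick-∈⁻ p y∈
... | inj₁ y≡x = inj₁ y≡x
... | inj₂ y∈T = inj₂ (there y∈T)

∑arr : Vec V k → (Vec V k → ℤ) → ℤ
∑arr {k = zero}  S f = f []
∑arr {k = suc _} S f = ∑pick S (λ x T → ∑arr T (λ u → f (x ∷ u)))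

∑arr-*ˡ : (S : Vec V k) (c : ℤ) (f : Vec V k → ℤ) → ∑arr S (λ u → c * f u) ≡ c * ∑arr S f
∑arr-*ˡ {k = zero}  S c f = refl
∑arr-*ˡ {k = suc _} S c f = trans (∑pick-cong S (λ {x} {T} _ → ∑arr-*ˡ T c _)) (∑pick-*ˡ S c _)

pathWeight : (V → V → ℤ) → Vec V k → ℤ
pathWeight A []          = 1ℤ
pathWeight A (x ∷ [])    = 1ℤ
pathWeight A (x ∷ y ∷ u) = A x y * pathWeight A (y ∷ u)

hamFrom-∑arr : ∀ (A : V → V → ℤ) a (S : Vec V k) →
  hamFrom A a S ≡ ∑arr S (λ u → pathWeight A (a ∷ u))
hamFrom-∑arr {k = zero}  A a S = refl
hamFrom-∑arr {k = suc _} A a S = ∑pick-cong S (λ {x} {T} _ →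
  trans (cong (A a x *_) (hamFrom-∑arr A x T)) (sym (∑arr-*ˡ T (A a x) _)))

ham-∑arr : ∀ (A : V → V → ℤ) (S : Vec V k) → ham A S ≡ ∑arr S (pathWeight A)
ham-∑arr {k = zero}  A S = refl
ham-∑arr {k = suc _} A S = ∑pick-cong S (λ {x} {T} _ → hamFrom-∑arr A x T)

module _ {n : ℕ} where

  Arr : ∀ {j k} → Vec (Fin n) j → Vec (Fin n) k → Set
  Arr S u = Unique u × All (Vec._∈ S) u

  arr? : ∀ {j k} (S : Vec (Fin n) j) (u : Vec (Fin n) k) → Dec (Arr S u)
  arr? S u = allPairs? (λ x y → ¬? (x ≟ y)) u ×-dec all? (_∈? S) u

  Arr-∷⁻ : ∀ {j k x} {T : Vec (Fin n) j} {S} {u : Vec (Fin n) k} → Pick x T S →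
    Arr S (x ∷ u) → Arr T u
  Arr-∷⁻ p (x∉u ∷ uu , _ ∷ u⊆S) = uu , All.map remove (All.zip (x∉u , u⊆S))
    where
    remove : ∀ {y} → _ ≢ y × y Vec.∈ _ → y Vec.∈ _
    remove (x≢y , y∈S) with Pick-∈⁻ p y∈S
    ... | inj₁ y≡x = contradiction (sym y≡x) x≢y
    ... | inj₂ y∈T = y∈T

  Arr-∷⁺ : ∀ {j k x} {T : Vec (Fin n) j} {S} {u : Vec (Fin n) k} → Pick x T S → Unique S →
    Arr T u → Arr S (x ∷ u)
  Arr-∷⁺ p uS (uu , u⊆T) with Pick-Unique p uS
  ... | x∉T ∷ _ = All.map (All.lookup x∉T) u⊆T ∷ uu , Pick-∈ p ∷ All.map (Pick-∈⁺ p) u⊆T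

  ∑-allVecs-suc : ∀ k (f : Vec (Fin n) (suc k) → ℤ) →
    ∑ (allVecs n (suc k)) f ≡ ∑ (allFin n) (λ x → ∑ (allVecs n k) (λ u → f (x ∷ u)))
  ∑-allVecs-suc k f = trans (∑-concatMap _ (allFin n) f)
    (∑-cong (allFin n) (λ {x} _ → ∑-map (x ∷_) (allVecs n k) f))

  -- This links the brute-force enumeration by `allVecs` to the recursion by picks: a first entry
  -- outside `S` contributes 0, and one inside `S` leaves an arrangement of the rest.
  ∑-allVecs-arr : (S : Vec (Fin n) k) → Unique S → (f : Vec (Fin n) k → ℤ) →
    ∑ (allVecs n k) (λ u → 𝟙 (arr? S u) * f u) ≡ ∑arr S f
  ∑-allVecs-arr {k = zero}  [] _ f = trans (+-identityʳ _) (*-identityˡ (f []))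
  ∑-allVecs-arr {k = suc k} S uS f = begin
    ∑ (allVecs n (suc k)) (λ u → 𝟙 (arr? S u) * f u)
      ≡⟨ ∑-allVecs-suc k _ ⟩
    ∑ (allFin n) ψ
      ≡⟨ ∑-cong (allFin n) (λ {x} _ → restrict x) ⟩
    ∑ (allFin n) (λ x → 𝟙 (x ∈? S) * ψ x)
      ≡⟨ ∑pick-∑ S uS ψ ⟨
    ∑pick S (λ x _ → ψ x)
      ≡⟨ ∑pick-cong S (λ {x} {T} p → trans
           (∑-cong (allVecs n k) (λ {u} _ → cong (_* f (x ∷ u))
             (𝟙-cong (arr? S (x ∷ u)) (arr? T u) (Arr-∷⁻ p) (Arr-∷⁺ p uS))))
           (∑-allVecs-arr T (Pick-AllPairs p uS) (λ u → f (x ∷ u)))) ⟩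
    ∑pick S (λ x T → ∑arr T (λ u → f (x ∷ u))) ∎
    where
    ψ : Fin n → ℤ
    ψ x = ∑ (allVecs n k) (λ u → 𝟙 (arr? S (x ∷ u)) * f (x ∷ u))
    restrict : ∀ x → ψ x ≡ 𝟙 (x ∈? S) * ψ x
    restrict x = 𝟙-absorb (x ∈? S) (λ x∉S → ∑-0 (allVecs n k) (λ {u} _ → trans
      (cong (_* f (x ∷ u)) (𝟙-no (arr? S (x ∷ u)) (λ (_ , u⊆S) → x∉S (All.head u⊆S))))
      (*-zeroˡ (f (x ∷ u)))))

  IsPerm⇒Arr : {u : Vec (Fin n) n} → IsPerm u → Arr (Vec.allFin n) u
  IsPerm⇒Arr {u} inj =
    subst Unique (Vec.tabulate∘lookup u) (Unique.tabulate⁺ (inj _ _)) ,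
    All.universal Vec.∈-allFin⁺ u

  Arr⇒IsPerm : {u : Vec (Fin n) n} → Arr (Vec.allFin n) u → IsPerm u
  Arr⇒IsPerm (uu , _) = Unique.lookup-injective uu

  ∈𝔖⇒IsPerm : {u : Vec (Fin n) n} → u ∈ 𝔖 n → IsPerm u
  ∈𝔖⇒IsPerm u∈ = proj₂ (∈-filter⁻ isPerm? {xs = allVecs n n} u∈)

  Unique-allFin : Unique (Vec.allFin n)
  Unique-allFin = Unique.tabulate⁺ id

  ∑-𝔖 : (f : Vec (Fin n) n → ℤ) → ∑ (𝔖 n) f ≡ ∑arr (Vec.allFin n) f
  ∑-𝔖 f = begin
    ∑ (𝔖 n) f
      ≡⟨ ∑-filter isPerm? (allVecs n n) f ⟩
    ∑ (allVecs n n) (λ u → 𝟙 (isPerm? u) * f u)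
      ≡⟨ ∑-cong (allVecs n n) (λ {u} _ → cong (_* f u)
           (𝟙-cong (isPerm? u) (arr? (Vec.allFin n) u) IsPerm⇒Arr Arr⇒IsPerm)) ⟩
    ∑ (allVecs n n) (λ u → 𝟙 (arr? (Vec.allFin n) u) * f u)
      ≡⟨ ∑-allVecs-arr (Vec.allFin n) Unique-allFin f ⟩
    ∑arr (Vec.allFin n) f ∎

-- Permutations without X-descents as Hamiltonian paths

module Edges (X : Subset²) (n : ℕ) where

  edge? : (i j : Fin n) → Dec (G X n i j)
  edge? i j = ¬? (i ≟ j) ×-dec ¬? (X (el i) (el j) Bool.≟ true)

  A : Fin n → Fin n → ℤ
  A i j = 𝟙 (edge? i j)

  -- An edge of `G X n` also demands distinct ends, which `NoXDes` does not mention; `Unique u`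
  -- supplies this.
  pathWeight-NoXDes : (u : Vec (Fin n) k) → Unique u →
    pathWeight A u ≡ 𝟙 (noXDes? X (map el (toList u)))
  pathWeight-NoXDes []          _ = refl
  pathWeight-NoXDes (x ∷ [])    _ = refl
  pathWeight-NoXDes (x ∷ y ∷ u) ((x≢y ∷ _) ∷ uu) = trans
    (cong₂ _*_ (𝟙-cong (edge? x y) (¬? (X (el x) (el y) Bool.≟ true)) proj₂ (x≢y ,_))
      (pathWeight-NoXDes (y ∷ u) uu))
    (sym (𝟙-× (¬? (X (el x) (el y) Bool.≟ true)) (noXDes? X (map el (toList (y ∷ u))))))

  dX∅-ham : pos (dX∅ X n) ≡ ham A (Vec.allFin n)
  dX∅-ham = begin
    pos (dX∅ X n)
      ≡⟨ length-∑ (filter noX? (𝔖 n)) ⟩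
    ∑ (filter noX? (𝔖 n)) (λ _ → 1ℤ)
      ≡⟨ trans (∑-filter noX? (𝔖 n) _) (∑-cong (𝔖 n) (λ {u} _ → *-identityʳ (𝟙 (noX? u)))) ⟩
    ∑ (𝔖 n) (λ u → 𝟙 (noX? u))
      ≡⟨ ∑-cong (𝔖 n) (λ {u} u∈ → sym (pathWeight-NoXDes u (proj₁ (IsPerm⇒Arr (∈𝔖⇒IsPerm u∈))))) ⟩
    ∑ (𝔖 n) (pathWeight A)
      ≡⟨ ∑-𝔖 (pathWeight A) ⟩
    ∑arr (Vec.allFin n) (pathWeight A)
      ≡⟨ ham-∑arr A (Vec.allFin n) ⟨
    ham A (Vec.allFin n) ∎
    where
    noX? : (u : Vec (Fin n) n) → Dec (XDesEmpty X u)
    noX? u = noXDes? X (map el (toList u))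

-- Orbits and local factors

∏ : List I → (I → ℤ) → ℤ
∏ []       f = 1ℤ
∏ (x ∷ xs) f = f x * ∏ xs f

∏-cong : (xs : List I) {f g : I → ℤ} → (∀ {x} → x ∈ xs → f x ≡ g x) → ∏ xs f ≡ ∏ xs g
∏-cong []       e = refl
∏-cong (x ∷ xs) e = cong₂ _*_ (e (here refl)) (∏-cong xs (e ∘ there))

∏-* : (xs : List I) (f g : I → ℤ) → ∏ xs (λ x → f x * g x) ≡ ∏ xs f * ∏ xs g
∏-* []       f g = refl
∏-* (x ∷ xs) f g = trans (cong (f x * g x *_) (∏-* xs f g)) (*-interchange (f x) (g x) (∏ xs f) (∏ xs g))

∏-1 : (xs : List I) {f : I → ℤ} → (∀ {x} → x ∈ xs → f x ≡ 1ℤ) → ∏ xs f ≡ 1ℤ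
∏-1 []       e = refl
∏-1 (x ∷ xs) e = cong₂ _*_ (e (here refl)) (∏-1 xs (e ∘ there))

∏-0 : {xs : List I} {f : I → ℤ} {y : I} → y ∈ xs → f y ≡ 0ℤ → ∏ xs f ≡ 0ℤ
∏-0 {xs = x ∷ xs} {f} (here refl) e = trans (cong (_* ∏ xs f) e) (*-zeroˡ (∏ xs f))
∏-0 {xs = x ∷ xs} {f} (there y∈)  e = trans (cong (f x *_) (∏-0 y∈ e)) (*-zeroʳ (f x))

𝟙-∀ : ∀ {n} {P : Fin n → Set} (P? : ∀ i → Dec (P i)) (d : Dec (∀ i → P i)) →
  𝟙 d ≡ ∏ (allFin n) (λ i → 𝟙 (P? i))
𝟙-∀ {n} P? (yes p) = sym (∏-1 (allFin n) (λ {i} _ → 𝟙-yes (P? i) (p i)))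
𝟙-∀ {n} {P} P? (no ¬p) with i , ¬pi ← Fin.¬∀⟶∃¬ n P P? ¬p = sym (∏-0 (∈-allFin i) (𝟙-no (P? i) ¬pi))

twice : Dec Φ → ℤ
twice d = if does d then pos 2 else 1ℤ

2^filter : {P : I → Set} (P? : ∀ x → Dec (P x)) (xs : List I) →
  pos (2 ℕ.^ length (filter P? xs)) ≡ ∏ xs (λ x → twice (P? x))
2^filter P? []       = refl
2^filter P? (x ∷ xs) with does (P? x)
... | true  = trans (pos-* 2 (2 ℕ.^ length (filter P? xs))) (cong (pos 2 *_) (2^filter P? xs))
... | false = trans (2^filter P? xs) (sym (*-identityˡ (∏ xs (λ x → twice (P? x)))))

alternating : ℕ → ℤ
alternating zero    = 1ℤ
alternating (suc k) = - alternating k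

-- The odd-length condition and the factor 2 of a nontrivial cycle merge into 1 - (-1)^k, the
-- coefficient found in the path recursion.
2*odd : ∀ k → 𝟙 (k % 2 ℕ.≟ 1) * pos 2 ≡ 1ℤ - alternating k
2*odd zero          = refl
2*odd (suc zero)    = refl
2*odd (suc (suc k)) = trans (2*odd k) (lem (alternating k))
  where
  lem : ∀ p → 1ℤ - p ≡ 1ℤ - - - p
  lem = solve-∀

module _ {n : ℕ} where

  iter-+ : ∀ (w : Vec (Fin n) n) j m i → iter w j (iter w m i) ≡ iter w (j ℕ.+ m) i
  iter-+ w zero    m i = refl
  iter-+ w (suc j) m i = cong (ap w) (iter-+ w j m i)

  iter-comm : ∀ (w : Vec (Fin n) n) j m i → iter w j (iter w m i) ≡ iter w m (iter w j i)
  iter-comm w j m i = trans (iter-+ w j m i)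
    (trans (cong (λ l → iter w l i) (ℕ.+-comm j m)) (sym (iter-+ w m j i)))

  iter-injective : ∀ {w : Vec (Fin n) n} → IsPerm w → ∀ m {i j} → iter w m i ≡ iter w m j → i ≡ j
  iter-injective perm zero    e = e
  iter-injective perm (suc m) e = iter-injective perm m (perm _ _ e)

  -- `d` is the distance from the start `j` of the search to the first return. The bound `d < fuel`
  -- rules out the default value 0 of an exhausted search.
  cycLenAux-first : ∀ (w : Vec (Fin n) n) i fuel j d → d < fuel →
    iter w (j ℕ.+ d) i ≡ i → (∀ {e} → e < d → iter w (j ℕ.+ e) i ≢ i) →
    cycLenAux w i fuel j ≡ j ℕ.+ d
  cycLenAux-first w i (suc fuel) j zero _ closes _
    rewrite ℕ.+-identityʳ j | dec-true (iter w j i ≟ i) closes = refl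
  cycLenAux-first w i (suc fuel) j (suc d) (s<s d<fuel) closes avoids
    rewrite dec-false (iter w j i ≟ i)
              (subst (λ l → iter w l i ≢ i) (ℕ.+-identityʳ j) (avoids z<s))
    = trans
      (cycLenAux-first w i fuel (suc j) d d<fuel
        (subst (λ l → iter w l i ≡ i) (ℕ.+-suc j d) closes)
        (λ {e} e<d → subst (λ l → iter w l i ≢ i) (ℕ.+-suc j e) (avoids (s<s e<d))))
      (sym (ℕ.+-suc j d))

  -- The latest iterate comes first and `v` last, matching the backward lists of walks.
  orbit : Vec (Fin n) n → Fin n → ℕ → List (Fin n)
  orbit w v zero    = []
  orbit w v (suc k) = iter w k v ∷ orbit w v k

  ∈-orbit⁺ : ∀ w v {j k} → j < k → iter w j v ∈ orbit w v k
  ∈-orbit⁺ w v {j} {suc k} j<1+k with ℕ.m≤n⇒m<n∨m≡n (ℕ.s≤s⁻¹ j<1+k)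
  ... | inj₁ j<k  = there (∈-orbit⁺ w v j<k)
  ... | inj₂ refl = here refl

  ∈-orbit⁻ : ∀ w v k {i} → i ∈ orbit w v k → ∃ λ m → m < k × i ≡ iter w m v
  ∈-orbit⁻ w v (suc k) (here e)  = k , ℕ.≤-refl , e
  ∈-orbit⁻ w v (suc k) (there i∈) with m , m<k , e ← ∈-orbit⁻ w v k i∈ = m , ℕ.m<n⇒m<1+n m<k , e

  orbit-distinct : ∀ w v k → List.Unique (orbit w v k) → ∀ {i j} → i < j → j < k →
    iter w j v ≢ iter w i v
  orbit-distinct w v (suc k) (fresh ∷ u) i<j j<1+k with ℕ.m≤n⇒m<n∨m≡n (ℕ.s≤s⁻¹ j<1+k)
  ... | inj₁ j<k  = orbit-distinct w v k u i<j j<k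
  ... | inj₂ refl = ListAll.lookup fresh (∈-orbit⁺ w v i<j)

  -- By pigeonhole. Both the fuel of `cycLen` and the iterates inspected by `IsCycleMin` are limited
  -- by `n`; this bound shows that they reach round the whole cycle.
  orbit-short : ∀ w v k → List.Unique (orbit w v k) → k ≤ n
  orbit-short w v k u = ℕ.≮⇒≥ λ n<k →
    let i , j , i<j , e = Fin.pigeonhole n<k (λ i → iter w (toℕ i) v)
    in orbit-distinct w v k u i<j (Fin.toℕ<n j) (sym e)

-- The list holds the walk backwards, its last vertex first.
walkWeight : (V → V → ℤ) → List V → ℤ
walkWeight M []          = 1ℤ
walkWeight M (a ∷ [])    = 1ℤ
walkWeight M (x ∷ a ∷ P) = M a x * walkWeight M (a ∷ P)

-- The k + 1 vertices have only k edges between them; the extra factor is the edge leaving the last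
-- vertex, which becomes the closing edge of a cycle.
walkWeight-orbit : ∀ {n} (M : Fin n → Fin n → ℤ) w v k →
  M (iter w k v) (iter w (suc k) v) * walkWeight M (orbit w v (suc k)) ≡
  ∏ (orbit w v (suc k)) (λ i → M i (ap w i))
walkWeight-orbit M w v zero    = refl
walkWeight-orbit M w v (suc k) =
  cong (M (iter w (suc k) v) (iter w (suc (suc k)) v) *_) (walkWeight-orbit M w v k)

∏-neg-orbit : ∀ {n} (f : Fin n → ℤ) w v k →
  ∏ (orbit w v k) (λ i → - f i) ≡ alternating k * ∏ (orbit w v k) f
∏-neg-orbit f w v zero    = refl
∏-neg-orbit f w v (suc k) = trans (cong (- f (iter w k v) *_) (∏-neg-orbit f w v k))
  (lem (f (iter w k v)) (alternating k) (∏ (orbit w v k) f))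
  where
  lem : ∀ a b c → (- a) * (b * c) ≡ (- b) * (a * c)
  lem = solve-∀

module Local (X : Subset²) (n : ℕ) where
  open Edges X n

  odd? : ∀ w i → Dec (cycLen {n} w i % 2 ≡ 1)
  odd? w i = cycLen w i % 2 ℕ.≟ 1

  directed? : ∀ (w : Vec (Fin n) n) i → Dec (ap w i ≢ i → rev (G X n) i (ap w i))
  directed? w i = ¬? (ap w i ≟ i) →-dec edge? (ap w i) i

  root? : ∀ (w : Vec (Fin n) n) i → Dec (ap w i ≢ i × IsCycleMin w i)
  root? w i = ¬? (ap w i ≟ i) ×-dec Fin.all? {n} (λ j → toℕ i ℕ.≤? toℕ (iter w (toℕ j) i))

  -- The summand of w is the product of these factors over all vertices; the 2
  -- of a nontrivial cycle sits at its minimum.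
  local : Vec (Fin n) n → Fin n → ℤ
  local w i = 𝟙 (odd? w i) * (𝟙 (directed? w i) * twice (root? w i))

  good-∏-local : ∀ w → 𝟙 (good? X n w) * pos (2 ℕ.^ nsc w) ≡ ∏ (allFin n) (local w)
  good-∏-local w = begin
    𝟙 (good? X n w) * pos (2 ℕ.^ nsc w)
      ≡⟨ cong₂ _*_ (trans (𝟙-× (oddOrder? w) (nontrivCyclesDirectedRevG? X w))
           (cong₂ _*_ (𝟙-∀ (odd? w) (oddOrder? w)) (𝟙-∀ (directed? w) (nontrivCyclesDirectedRevG? X w)))) (2^filter (root? w) (allFin n)) ⟩
    a * b * c
      ≡⟨ *-assoc a b c ⟩
    a * (b * c)
      ≡⟨ trans (∏-* (allFin n) (𝟙 ∘ odd? w) (λ i → 𝟙 (directed? w i) * twice (root? w i)))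
           (cong (a *_) (∏-* (allFin n) (𝟙 ∘ directed? w) (twice ∘ root? w))) ⟨
    ∏ (allFin n) (local w) ∎
    where
    a = ∏ (allFin n) (𝟙 ∘ odd? w)
    b = ∏ (allFin n) (𝟙 ∘ directed? w)
    c = ∏ (allFin n) (twice ∘ root? w)

  local-fixed : ∀ (w : Vec (Fin n) n) v → ap w v ≡ v → local w v ≡ 1ℤ
  local-fixed w v fixed = cong₂ _*_ (𝟙-yes (odd? w v) (cong (_% 2) (cyc w v fixed)))
    (cong₂ _*_ (𝟙-yes (directed? w v) (contradiction fixed))
      (cong (if_then pos 2 else 1ℤ) (dec-false (root? w v) (λ (moved , _) → moved fixed))))
    where
    cyc : ∀ {n} (w : Vec (Fin n) n) v → ap w v ≡ v → cycLen w v ≡ 1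
    cyc {suc n} w v fixed = cycLenAux-first w v (suc n) 1 0 z<s fixed (λ ())

  module _ {w : Vec (Fin n) n} (perm : IsPerm w) (v : Fin n) (l : ℕ) where

    private
      ℓ : ℕ
      ℓ = suc (suc l)

    module _ (unique : List.Unique (orbit w v ℓ)) (closes : iter w ℓ v ≡ v)
             (least : ListAll.All (λ i → toℕ v ≤ toℕ i) (orbit w v ℓ)) where

      private
        avoids : ∀ {j} → 0 < j → j < ℓ → iter w j v ≢ v
        avoids = orbit-distinct w v ℓ unique

        ℓ≤n : ℓ ≤ n
        ℓ≤n = orbit-short w v ℓ unique

        stays : ∀ j → iter w j v ∈ orbit w v ℓ
        stays zero = ∈-orbit⁺ w v {0} {ℓ} z<s
        stays (suc j) with m , m<ℓ , e ← ∈-orbit⁻ w v ℓ (stays j) | ℕ.m≤n⇒m<n∨m≡n m<ℓ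
        ... | inj₁ 1+m<ℓ = subst (_∈ orbit w v ℓ) (cong (ap w) (sym e)) (∈-orbit⁺ w v 1+m<ℓ)
        ... | inj₂ refl  = subst (_∈ orbit w v ℓ) (trans (sym closes) (cong (ap w) (sym e)))
                             (∈-orbit⁺ w v {0} {ℓ} z<s)

        cycLen-orbit : ∀ m → cycLen w (iter w m v) ≡ ℓ
        cycLen-orbit m = cycLenAux-first w (iter w m v) n 1 (suc l) ℓ≤n
          (trans (iter-comm w ℓ m v) (cong (iter w m) closes))
          (λ {e} e<1+l eq → avoids z<s (s<s e<1+l)
            (iter-injective perm m (trans (iter-comm w m (suc e) v) eq)))

        moves : ∀ m → ap w (iter w m v) ≢ iter w m v
        moves m eq = avoids {1} z<s (s<s z<s) (iter-injective perm m (trans (iter-comm w m 1 v) eq))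

        root-v : ap w v ≢ v × IsCycleMin w v
        root-v = moves 0 , λ j → ListAll.lookup least (stays (toℕ j))

        -- From `iter w m v`, another `ℓ ∸ m` steps lead back to `v`. A minimum there would be at
        -- most `v`, hence equal to `v`, before the first return.
        not-root : ∀ {m} → 0 < m → m < ℓ → ¬ IsCycleMin w (iter w m v)
        not-root {m} 0<m m<ℓ min = avoids 0<m m<ℓ (Fin.toℕ-injective (ℕ.≤-antisym
          (subst (λ i → toℕ (iter w m v) ≤ toℕ i) back (min (fromℕ< ℓ∸m<n)))
          (ListAll.lookup least (stays m))))
          where
          -- Positivity of `m` makes `ℓ ∸ m` smaller than `ℓ`, so the return lies among the `n`
          -- iterates that `IsCycleMin` tests.
          ℓ∸m<n : ℓ ∸ m < n
          ℓ∸m<n = ℕ.<-≤-trans (ℕ.∸-monoʳ-< 0<m (ℕ.<⇒≤ m<ℓ)) ℓ≤n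
          back : iter w (toℕ (fromℕ< ℓ∸m<n)) (iter w m v) ≡ v
          back = begin
            iter w (toℕ (fromℕ< ℓ∸m<n)) (iter w m v)
              ≡⟨ cong (λ j → iter w j (iter w m v)) (Fin.toℕ-fromℕ< ℓ∸m<n) ⟩
            iter w (ℓ ∸ m) (iter w m v)
              ≡⟨ iter-+ w (ℓ ∸ m) m v ⟩
            iter w (ℓ ∸ m ℕ.+ m) v
              ≡⟨ cong (λ j → iter w j v) (ℕ.m∸n+n≡m (ℕ.<⇒≤ m<ℓ)) ⟩
            iter w ℓ v
              ≡⟨ closes ⟩
            v ∎

        ∏-twice : ∀ j → j < ℓ → ∏ (orbit w v (suc j)) (twice ∘ root? w) ≡ pos 2
        ∏-twice zero    _     = trans (*-identityʳ (twice (root? w v)))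
          (cong (if_then pos 2 else 1ℤ) (dec-true (root? w v) root-v))
        ∏-twice (suc j) 1+j<ℓ = cong₂ _*_
          (cong (if_then pos 2 else 1ℤ) (dec-false (root? w (iter w (suc j) v)) (not-root z<s 1+j<ℓ ∘ proj₂)))
          (∏-twice j (ℕ.<-trans ℕ.≤-refl 1+j<ℓ))

        ∏-odd : ∀ j → ∏ (orbit w v (suc j)) (𝟙 ∘ odd? w) ≡ 𝟙 (ℓ % 2 ℕ.≟ 1)
        ∏-odd j = trans (∏-cong (orbit w v (suc j)) (λ {i} i∈ →
            let m , _ , e = ∈-orbit⁻ w v (suc j) i∈
            in cong (λ c → 𝟙 (c % 2 ℕ.≟ 1)) (trans (cong (cycLen w) e) (cycLen-orbit m))))
          (idem j)
          where
          𝟙-idem : (d : Dec Φ) → 𝟙 d * 𝟙 d ≡ 𝟙 d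
          𝟙-idem (yes _) = refl
          𝟙-idem (no _)  = refl
          idem : ∀ j → ∏ (orbit w v (suc j)) (λ _ → 𝟙 (ℓ % 2 ℕ.≟ 1)) ≡ 𝟙 (ℓ % 2 ℕ.≟ 1)
          idem zero    = *-identityʳ _
          idem (suc j) = trans (cong (𝟙 (ℓ % 2 ℕ.≟ 1) *_) (idem j)) (𝟙-idem (ℓ % 2 ℕ.≟ 1))

        ∏-directed : ∏ (orbit w v ℓ) (𝟙 ∘ directed? w) ≡ ∏ (orbit w v ℓ) (λ i → flip A i (ap w i))
        ∏-directed = ∏-cong (orbit w v ℓ) (λ {i} i∈ →
          let m , _ , e = ∈-orbit⁻ w v ℓ i∈
          in 𝟙-cong (directed? w i) (edge? (ap w i) i)
               (λ d → d (subst (λ i → ap w i ≢ i) (sym e) (moves m))) (λ d _ → d))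

      -- All parity factors on the cycle coincide and are idempotent, and only `v` contributes a 2.
      -- What remains is 2·[ℓ odd] = 1 - (-1)^ℓ times the edge product, and the sign is absorbed
      -- into the negated edges.
      ∏-local-cycle : ∏ (orbit w v ℓ) (local w) ≡
        ∏ (orbit w v ℓ) (λ i → flip A i (ap w i)) - ∏ (orbit w v ℓ) (λ i → neg (flip A) i (ap w i))
      ∏-local-cycle = begin
        ∏ O (local w)
          ≡⟨ trans (∏-* O (𝟙 ∘ odd? w) (λ i → 𝟙 (directed? w i) * twice (root? w i)))
               (cong (∏ O (𝟙 ∘ odd? w) *_) (∏-* O (𝟙 ∘ directed? w) (twice ∘ root? w))) ⟩
        ∏ O (𝟙 ∘ odd? w) * (∏ O (𝟙 ∘ directed? w) * ∏ O (twice ∘ root? w))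
          ≡⟨ cong₂ _*_ (∏-odd (suc l)) (cong₂ _*_ ∏-directed (∏-twice (suc l) ℕ.≤-refl)) ⟩
        𝟙 (ℓ % 2 ℕ.≟ 1) * (π * pos 2)
          ≡⟨ lem₁ (𝟙 (ℓ % 2 ℕ.≟ 1)) π (pos 2) ⟩
        𝟙 (ℓ % 2 ℕ.≟ 1) * pos 2 * π
          ≡⟨ cong (_* π) (2*odd ℓ) ⟩
        (1ℤ - alternating ℓ) * π
          ≡⟨ lem₂ (alternating ℓ) π ⟩
        π - alternating ℓ * π
          ≡⟨ cong (λ z → π - z) (∏-neg-orbit (λ i → flip A i (ap w i)) w v ℓ) ⟨
        π - ∏ O (λ i → neg (flip A) i (ap w i)) ∎
        where
        O = orbit w v ℓ
        π = ∏ O (λ i → flip A i (ap w i))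
        lem₁ : ∀ a b c → a * (b * c) ≡ a * c * b
        lem₁ = solve-∀
        lem₂ : ∀ a b → (1ℤ - a) * b ≡ b - a * b
        lem₂ = solve-∀

∏-Pick : ∀ {x : V} {T : Vec V k} {S} → Pick x T S → (f : V → ℤ) →
  ∏ (toList S) f ≡ f x * ∏ (toList T) f
∏-Pick here f = refl
∏-Pick {x = x} (there {y = y} {T = T} p) f =
  trans (cong (f y *_) (∏-Pick p f)) (*-swap (f y) (f x) (∏ (toList T) f))

-- Building permutations cycle by cycle

-- The list is kept backwards so that appending a vertex to the walk is a cons.
data Walk {V : Set} (σ : V → V) (v : V) : List V → Set where
  start : Walk σ v (v ∷ [])
  step  : ∀ {a x P} → σ a ≡ x → Walk σ v (a ∷ P) → Walk σ v (x ∷ a ∷ P)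

-- The last vertex `a` is exempt: no step of the walk leaves it, and its image is what an extension
-- of the cycle changes.
walk-cong : ∀ {σ τ : V → V} {v a P} → (∀ {p} → p ∈ P → σ p ≡ τ p) → Walk σ v (a ∷ P) → Walk τ v (a ∷ P)
walk-cong e start      = start
walk-cong e (step q W) = step (trans (sym (e (here refl))) q) (walk-cong (e ∘ there) W)

toList-tabulate : ∀ {m} (f : Fin m → V) → toList (tabulate f) ≡ List.tabulate f
toList-tabulate {m = zero}  f = refl
toList-tabulate {m = suc _} f = cong (f Fin.zero ∷_) (toList-tabulate (f ∘ Fin.suc))

walk-orbit : ∀ {n} (w : Vec (Fin n) n) {v a P} → Walk (ap w) v (a ∷ P) →
  a ∷ P ≡ orbit w v (length (a ∷ P))
walk-orbit w start = refl
walk-orbit w (step {a = a} {P = P} q W) with walk-orbit w W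
... | e = cong₂ _∷_ (trans (sym q) (cong (ap w) (∷-injectiveˡ e))) e

injective⇒surjective : ∀ {n} {σ : Fin n → Fin n} → Injective _≡_ _≡_ σ → ∀ y → ∃ λ x → σ x ≡ y
injective⇒surjective {suc n} {σ} inj y with Fin.any? (λ x → σ x ≟ y)
... | yes found  = found
... | no  missed = contradiction (Fin.injective⇒≤ {f = λ x → punchOut (avoid x)}
                     (λ {i} {j} e → inj (Fin.punchOut-injective (avoid i) (avoid j) e))) ℕ.1+n≰n
  where
  avoid : ∀ x → y ≢ σ x
  avoid x e = missed (x , sym e)

module _ {n : ℕ} where

  transpose-ˡ : ∀ (a x : Fin n) → transpose a x a ≡ x
  transpose-ˡ a x rewrite dec-true (a ≟ a) refl = refl

  transpose-ʳ : ∀ (a x : Fin n) → a ≢ x → transpose a x x ≡ a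
  transpose-ʳ a x a≢x rewrite dec-false (x ≟ a) (≢-sym a≢x) | dec-true (x ≟ x) refl = refl

  transpose-other : ∀ (a x : Fin n) {i} → i ≢ a → i ≢ x → transpose a x i ≡ i
  transpose-other a x {i} i≢a i≢x rewrite dec-false (i ≟ a) i≢a | dec-false (i ≟ x) i≢x = refl

  transpose-injective : ∀ (a x : Fin n) → Injective _≡_ _≡_ (transpose a x)
  transpose-injective a x e =
    trans (sym (transpose-inverse x a)) (trans (cong (transpose x a) e) (transpose-inverse x a))

  -- The images of `S` under `w` are still undecided. For an open cycle ending in `a` the undecided
  -- set is `a ∷ S`; taking `S` instead accepts the closure given by `σ`.
  AgreeOff : (Fin n → Fin n) → Vec (Fin n) k → Vec (Fin n) n → Set
  AgreeOff σ S w = ∀ i → i Vec.∉ S → ap w i ≡ σ i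

  agreeOff? : ∀ σ (S : Vec (Fin n) k) w → Dec (AgreeOff σ S w)
  agreeOff? σ S w = Fin.all? (λ i → ¬? (i ∈? S) →-dec (ap w i ≟ σ i))

  ∑-allVecs-≡ : (c : Vec (Fin n) k) → ∑ (allVecs n k) (λ u → 𝟙 (Vec.≡-dec _≟_ u c)) ≡ 1ℤ
  ∑-allVecs-≡ []      = refl
  ∑-allVecs-≡ {k = suc k} (y ∷ c) = begin
    ∑ (allVecs n (suc k)) (λ u → 𝟙 (Vec.≡-dec _≟_ u (y ∷ c)))
      ≡⟨ ∑-allVecs-suc k (λ u → 𝟙 (Vec.≡-dec _≟_ u (y ∷ c))) ⟩
    ∑ (allFin n) (λ x → ∑ (allVecs n k) (λ u → 𝟙 (Vec.≡-dec _≟_ (x ∷ u) (y ∷ c))))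
      ≡⟨ ∑-cong (allFin n) (λ {x} _ → trans
           (trans (∑-cong (allVecs n k) (λ {u} _ → 𝟙-× (x ≟ y) (Vec.≡-dec _≟_ u c)))
             (∑-*ˡ (allVecs n k) (𝟙 (x ≟ y)) _))
           (cong (𝟙 (x ≟ y) *_) (∑-allVecs-≡ c))) ⟩
    ∑ (allFin n) (λ x → 𝟙 (x ≟ y) * 1ℤ)
      ≡⟨ ∑-allFin-delta y (λ _ → 1ℤ) ⟩
    1ℤ ∎

  ∑-agree-everywhere : ∀ {σ} → Injective _≡_ _≡_ σ → ∑ (𝔖 n) (λ w → 𝟙 (agreeOff? σ [] w)) ≡ 1ℤ
  ∑-agree-everywhere {σ} inj = begin
    ∑ (𝔖 n) (λ w → 𝟙 (agreeOff? σ [] w))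
      ≡⟨ ∑-filter isPerm? (allVecs n n) _ ⟩
    ∑ (allVecs n n) (λ w → 𝟙 (isPerm? w) * 𝟙 (agreeOff? σ [] w))
      ≡⟨ ∑-cong (allVecs n n) (λ {w} _ → trans (sym (𝟙-× (isPerm? w) (agreeOff? σ [] w)))
           (𝟙-cong (isPerm? w ×-dec agreeOff? σ [] w) (Vec.≡-dec _≟_ w (tabulate σ))
             (λ (_ , agree) → trans (sym (Vec.tabulate∘lookup w)) (Vec.tabulate-cong (λ i → agree i (λ ()))))
             (λ { refl → (λ i j e → inj (trans (sym (Vec.lookup∘tabulate σ i)) (trans e (Vec.lookup∘tabulate σ j))))
                       , λ i _ → Vec.lookup∘tabulate σ i }))) ⟩
    ∑ (allVecs n n) (λ w → 𝟙 (Vec.≡-dec _≟_ w (tabulate σ)))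
      ≡⟨ ∑-allVecs-≡ (tabulate σ) ⟩
    1ℤ ∎

  module _ {σ : Fin n → Fin n} (inj : Injective _≡_ _≡_ σ) {v a : Fin n} (σa≡v : σ a ≡ v)
           {S : Vec (Fin n) k} (fix : ∀ {s} → s Vec.∈ S → σ s ≡ s) (a∉S : a Vec.∉ S) where

    -- Any other value is taken: it is `σ z` for some `z` outside `a ∷ S`, where `w` agrees with
    -- `σ`, so injectivity of `w` forces `z` to be `a`, which is excluded.
    image-a : ∀ w → IsPerm w → AgreeOff σ (a ∷ S) w → ap w a Vec.∈ (v ∷ S)
    image-a w perm agree with ap w a ∈? (v ∷ S)
    ... | yes wa∈ = wa∈
    ... | no  wa∉ with z , σz≡wa ← injective⇒surjective inj (ap w a) =
      contradiction (here (trans (sym σz≡wa) (trans (cong σ z≡a) σa≡v))) wa∉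
      where
      z∉ : z Vec.∉ (a ∷ S)
      z∉ (here refl) = wa∉ (here (trans (sym σz≡wa) σa≡v))
      z∉ (there z∈S) = wa∉ (there (subst (Vec._∈ S) (trans (sym (fix z∈S)) σz≡wa) z∈S))
      z≡a : z ≡ a
      z≡a = perm z a (trans (agree z z∉) σz≡wa)

    agree-close : ∀ w → 𝟙 (agreeOff? σ S w) ≡ 𝟙 (agreeOff? σ (a ∷ S) w) * 𝟙 (ap w a ≟ v)
    agree-close w = trans
      (𝟙-cong (agreeOff? σ S w) (agreeOff? σ (a ∷ S) w ×-dec (ap w a ≟ v))
        (λ agree → (λ i i∉ → agree i (i∉ ∘ there)) , trans (agree a a∉S) σa≡v)
        (λ (agree , wa≡v) i i∉S → glue agree wa≡v i i∉S (i ≟ a)))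
      (𝟙-× (agreeOff? σ (a ∷ S) w) (ap w a ≟ v))
      where
      glue : AgreeOff σ (a ∷ S) w → ap w a ≡ v → ∀ i → i Vec.∉ S → Dec (i ≡ a) → ap w i ≡ σ i
      glue agree wa≡v i i∉S (yes refl) = trans wa≡v (sym σa≡v)
      glue agree wa≡v i i∉S (no i≢a)   = agree i λ { (here i≡a) → i≢a i≡a ; (there i∈S) → i∉S i∈S }

  module _ {σ : Fin n → Fin n} {a x : Fin n} {T : Vec (Fin n) k} {S : Vec (Fin n) (suc k)}
           (p : Pick x T S) (a∉S : a Vec.∉ S) (fix : σ x ≡ x) where

    a≢x : a ≢ x
    a≢x refl = a∉S (Pick-∈ p)

    -- As sets, `x ∷ T` and `S` are equal, so the only new decision is the image of `a`, and the
    -- composite sends `a` to `σ x = x`. The image of `x`, the new end, stays open.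
    agree-extend : ∀ w → 𝟙 (agreeOff? (σ ∘ transpose a x) (x ∷ T) w) ≡
                         𝟙 (agreeOff? σ (a ∷ S) w) * 𝟙 (ap w a ≟ x)
    agree-extend w = trans
      (𝟙-cong (agreeOff? (σ ∘ transpose a x) (x ∷ T) w) (agreeOff? σ (a ∷ S) w ×-dec (ap w a ≟ x))
        (λ agree → (λ i i∉ → trans (agree i (i∉ ∘ widen)) (cong σ (transpose-other a x (i∉ ∘ here)
                               (λ { refl → i∉ (there (Pick-∈ p)) }))))
                 , trans (agree a a∉) (trans (cong σ (transpose-ˡ a x)) fix))
        (λ (agree , wa≡x) i i∉ → glue agree wa≡x i i∉ (i ≟ a)))
      (𝟙-× (agreeOff? σ (a ∷ S) w) (ap w a ≟ x))
      where
      widen : ∀ {i} → i Vec.∈ (x ∷ T) → i Vec.∈ (a ∷ S)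
      widen (here refl) = there (Pick-∈ p)
      widen (there i∈T) = there (Pick-∈⁺ p i∈T)
      a∉ : a Vec.∉ (x ∷ T)
      a∉ (here a≡x)  = a≢x a≡x
      a∉ (there a∈T) = a∉S (Pick-∈⁺ p a∈T)
      glue : AgreeOff σ (a ∷ S) w → ap w a ≡ x → ∀ i → i Vec.∉ (x ∷ T) → Dec (i ≡ a) →
        ap w i ≡ σ (transpose a x i)
      glue agree wa≡x i i∉ (yes refl) = trans wa≡x (sym (trans (cong σ (transpose-ˡ a x)) fix))
      glue agree wa≡x i i∉ (no i≢a)   = trans
        (agree i λ { (here i≡a) → i≢a i≡a ; (there i∈S) → i∉ ([ here , there ]′ (Pick-∈⁻ p i∈S)) })
        (cong σ (sym (transpose-other a x i≢a (i∉ ∘ here))))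

  ∑pick-≟ : ∀ (S : Vec (Fin n) (suc k)) → Unique S → ∀ y → ∑pick S (λ x _ → 𝟙 (y ≟ x)) ≡ 𝟙 (y ∈? S)
  ∑pick-≟ S uS y = begin
    ∑pick S (λ x _ → 𝟙 (y ≟ x))
      ≡⟨ ∑pick-∑ S uS (λ x → 𝟙 (y ≟ x)) ⟩
    ∑ (allFin n) (λ x → 𝟙 (x ∈? S) * 𝟙 (y ≟ x))
      ≡⟨ ∑-cong (allFin n) (λ {x} _ → trans (*-comm (𝟙 (x ∈? S)) (𝟙 (y ≟ x)))
           (cong (_* 𝟙 (x ∈? S)) (𝟙-cong (y ≟ x) (x ≟ y) sym sym))) ⟩
    ∑ (allFin n) (λ x → 𝟙 (x ≟ y) * 𝟙 (x ∈? S))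
      ≡⟨ ∑-allFin-delta y (λ x → 𝟙 (x ∈? S)) ⟩
    𝟙 (y ∈? S) ∎

  Sorted : Vec (Fin n) k → Set
  Sorted = AllPairs Fin._<_

  Sorted-tabulate : ∀ {m} (f : Fin m → Fin n) → (∀ {i j} → i Fin.< j → f i Fin.< f j) →
    Sorted (tabulate f)
  Sorted-tabulate {zero}  f mono = []
  Sorted-tabulate {suc m} f mono =
    All.tabulate⁺ (λ j → mono z<s) ∷ Sorted-tabulate (f ∘ Fin.suc) (mono ∘ s<s)

  Sorted⇒Unique : {S : Vec (Fin n) k} → Sorted S → Unique S
  Sorted⇒Unique = AllPairs.map Fin.<⇒≢

  -- A partially built permutation.  σ is already a permutation: the cycle under
  -- construction, v → ⋯ → a with vertices a ∷ P, is closed up provisionally by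
  -- σ a ≡ v, and the unused vertices S are fixed.  Appending x ∈ S to the cycle
  -- replaces σ by σ ∘ transpose a x.
  record OpenCycle (σ : Fin n → Fin n) (v a : Fin n) (P : List (Fin n)) (S : Vec (Fin n) k) : Set where
    field
      injective : Injective _≡_ _≡_ σ
      closes    : σ a ≡ v
      walk      : Walk σ v (a ∷ P)
      unique    : List.Unique (a ∷ P)
      least     : ListAll.All (λ i → toℕ v ≤ toℕ i) (a ∷ P)
      disjoint  : ∀ {i} → i ∈ a ∷ P → i Vec.∉ S
      fixes     : ∀ {s} → s Vec.∈ S → σ s ≡ s
      above     : All (v Fin.<_) S
      sorted    : Sorted S

    a∉S : a Vec.∉ S
    a∉S = disjoint (here refl)

    v∉S : All (v ≢_) S
    v∉S = All.map Fin.<⇒≢ above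

  open OpenCycle

  extend : ∀ {σ v a P} {T : Vec (Fin n) k} {S x} → OpenCycle σ v a P S → Pick x T S →
    OpenCycle (σ ∘ transpose a x) v x (a ∷ P) T
  extend {σ = σ} {v} {a} {P} {T} {S} {x} o p = record
    { injective = transpose-injective a x ∘ injective o
    ; closes    = trans (cong σ (transpose-ʳ a x (x∉L (here refl) ∘ sym))) (closes o)
    ; walk      = step (trans (cong σ (transpose-ˡ a x)) (fixes o x∈S))
                    (walk-cong (λ i∈P → cong σ (sym (transpose-other a x
                      (≢-sym (ListAll.lookup (a∉P (unique o)) i∈P)) (≢-sym (x∉L (there i∈P)))))) (walk o))
    ; unique    = ListAll.tabulate x∉L ∷ unique o
    ; least     = ℕ.<⇒≤ (proj₁ v<) ListAll.∷ least o
    ; disjoint  = λ { (here refl) i∈T → x∉T i∈T refl ; (there i∈) i∈T → disjoint o i∈ (Pick-∈⁺ p i∈T) }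
    ; fixes     = λ {t} t∈T → trans (cong σ (transpose-other a x
                    (λ { refl → a∉S o (Pick-∈⁺ p t∈T) }) (≢-sym (x∉T t∈T)))) (fixes o (Pick-∈⁺ p t∈T))
    ; above     = proj₂ v<
    ; sorted    = Pick-AllPairs p (sorted o)
    }
    where
    x∈S = Pick-∈ p
    v<  = Pick-All p (above o)
    x∉T : ∀ {t} → t Vec.∈ T → x ≢ t
    x∉T = All.lookup (AllPairs.head (Pick-Unique p (Sorted⇒Unique (sorted o))))
    x∉L : ∀ {i} → i ∈ a ∷ P → x ≢ i
    x∉L i∈ refl = disjoint o i∈ x∈S
    a∉P : List.Unique (a ∷ P) → ListAll.All (a ≢_) P
    a∉P (fresh ∷ _) = fresh

  module _ {σ v a P} {S : Vec (Fin n) k} (o : OpenCycle σ v a P S) where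

    𝟙-image : ∀ w → IsPerm w → 𝟙 (agreeOff? σ (a ∷ S) w) ≡
      𝟙 (agreeOff? σ (a ∷ S) w) * (𝟙 (ap w a ≟ v) + 𝟙 (ap w a ∈? S))
    𝟙-image w perm = trans (sym (*-identityʳ (𝟙 (agreeOff? σ (a ∷ S) w))))
      (𝟙-*-cong (agreeOff? σ (a ∷ S) w) (λ agree → trans
        (sym (𝟙-yes (ap w a ∈? (v ∷ S)) (image-a (injective o) (closes o) (fixes o) (a∉S o) w perm agree)))
        (𝟙-∈-∷ (ap w a) v S (v∉S o))))

  split₀ : ∀ {σ v a P} → OpenCycle σ v a P [] → (f : Vec (Fin n) n → ℤ) →
    ∑ (𝔖 n) (λ w → 𝟙 (agreeOff? σ (a ∷ []) w) * f w) ≡ ∑ (𝔖 n) (λ w → 𝟙 (agreeOff? σ [] w) * f w)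
  split₀ {σ} {v} {a} o f = ∑-cong (𝔖 n) (λ {w} w∈ → cong (_* f w) (begin
    𝟙 (agreeOff? σ (a ∷ []) w)
      ≡⟨ 𝟙-image o w (∈𝔖⇒IsPerm w∈) ⟩
    𝟙 (agreeOff? σ (a ∷ []) w) * (𝟙 (ap w a ≟ v) + 0ℤ)
      ≡⟨ cong (𝟙 (agreeOff? σ (a ∷ []) w) *_) (+-identityʳ (𝟙 (ap w a ≟ v))) ⟩
    𝟙 (agreeOff? σ (a ∷ []) w) * 𝟙 (ap w a ≟ v)
      ≡⟨ agree-close (injective o) (closes o) (fixes o) (a∉S o) w ⟨
    𝟙 (agreeOff? σ [] w) ∎))

  split : ∀ {σ v a P} {S : Vec (Fin n) (suc k)} → OpenCycle σ v a P S → (f : Vec (Fin n) n → ℤ) →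
    ∑ (𝔖 n) (λ w → 𝟙 (agreeOff? σ (a ∷ S) w) * f w) ≡
    ∑ (𝔖 n) (λ w → 𝟙 (agreeOff? σ S w) * f w) +
    ∑pick S (λ x T → ∑ (𝔖 n) (λ w → 𝟙 (agreeOff? (σ ∘ transpose a x) (x ∷ T) w) * f w))
  split {σ = σ} {v} {a} {P} {S} o f = begin
    ∑ (𝔖 n) (λ w → 𝟙 (agreeOff? σ (a ∷ S) w) * f w)
      ≡⟨ ∑-cong (𝔖 n) (λ {w} w∈ → pointwise w (∈𝔖⇒IsPerm w∈)) ⟩
    ∑ (𝔖 n) (λ w → 𝟙 (agreeOff? σ S w) * f w +
                   ∑pick S (λ x T → 𝟙 (agreeOff? (σ ∘ transpose a x) (x ∷ T) w) * f w))
      ≡⟨ ∑-+ (𝔖 n) _ _ ⟩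
    ∑ (𝔖 n) (λ w → 𝟙 (agreeOff? σ S w) * f w) +
    ∑ (𝔖 n) (λ w → ∑pick S (λ x T → 𝟙 (agreeOff? (σ ∘ transpose a x) (x ∷ T) w) * f w))
      ≡⟨ cong (∑ (𝔖 n) (λ w → 𝟙 (agreeOff? σ S w) * f w) +_) (∑-∑pick (𝔖 n) S _) ⟩
    ∑ (𝔖 n) (λ w → 𝟙 (agreeOff? σ S w) * f w) +
    ∑pick S (λ x T → ∑ (𝔖 n) (λ w → 𝟙 (agreeOff? (σ ∘ transpose a x) (x ∷ T) w) * f w)) ∎
    where
    pointwise : ∀ w → IsPerm w → 𝟙 (agreeOff? σ (a ∷ S) w) * f w ≡
      𝟙 (agreeOff? σ S w) * f w +
      ∑pick S (λ x T → 𝟙 (agreeOff? (σ ∘ transpose a x) (x ∷ T) w) * f w)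
    pointwise w perm = begin
      α * f w
        ≡⟨ cong (_* f w) (𝟙-image o w perm) ⟩
      α * (𝟙 (ap w a ≟ v) + 𝟙 (ap w a ∈? S)) * f w
        ≡⟨ cong (λ z → α * (𝟙 (ap w a ≟ v) + z) * f w) (∑pick-≟ S (Sorted⇒Unique (sorted o)) (ap w a)) ⟨
      α * (𝟙 (ap w a ≟ v) + ∑pick S (λ x _ → 𝟙 (ap w a ≟ x))) * f w
        ≡⟨ lem α (𝟙 (ap w a ≟ v)) (∑pick S (λ x _ → 𝟙 (ap w a ≟ x))) (f w) ⟩
      α * 𝟙 (ap w a ≟ v) * f w + α * ∑pick S (λ x _ → 𝟙 (ap w a ≟ x)) * f w
        ≡⟨ cong₂ _+_ (cong (_* f w) (sym (agree-close (injective o) (closes o) (fixes o) (a∉S o) w)))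
             (trans (cong (_* f w) (sym (∑pick-*ˡ S α _))) (sym (∑pick-*ʳ S (f w) _))) ⟩
      𝟙 (agreeOff? σ S w) * f w + ∑pick S (λ x _ → α * 𝟙 (ap w a ≟ x) * f w)
        ≡⟨ cong (𝟙 (agreeOff? σ S w) * f w +_) (∑pick-cong S (λ p →
             cong (_* f w) (sym (agree-extend p (a∉S o) (fixes o (Pick-∈ p)) w)))) ⟩
      𝟙 (agreeOff? σ S w) * f w +
      ∑pick S (λ x T → 𝟙 (agreeOff? (σ ∘ transpose a x) (x ∷ T) w) * f w) ∎
      where
      α = 𝟙 (agreeOff? σ (a ∷ S) w)
      lem : ∀ a b c d → a * (b + c) * d ≡ a * b * d + a * c * d
      lem = solve-∀

-- The same recursion for the weighted sum over permutations

module Count (X : Subset²) (n : ℕ) (tournament : IsTournament (G X n)) where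
  open Edges X n
  open Local X n
  open OpenCycle

  A-loopless : ∀ i → A i i ≡ 0ℤ
  A-loopless i = 𝟙-no (edge? i i) (λ (i≢i , _) → i≢i refl)

  A-tournament : ∀ {i j} → i ≢ j → A i j + A j i ≡ 1ℤ
  A-tournament {i} {j} i≢j with tournament i j i≢j
  ... | inj₁ (e , ¬e) = cong₂ _+_ (𝟙-yes (edge? i j) e) (𝟙-no (edge? j i) ¬e)
  ... | inj₂ (e , ¬e) = cong₂ _+_ (𝟙-no (edge? i j) ¬e) (𝟙-yes (edge? j i) e)

  M N : Fin n → Fin n → ℤ
  M = flip A
  N = neg M

  h : Weight (Fin n)
  h = ham A

  -- Only the local factors on `L` are multiplied. Taking `L` to be the undecided vertices omits the
  -- finished cycles, whose factors are constant and pulled out of the sum.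
  completions : (Fin n → Fin n) → ∀ {j} → Vec (Fin n) j → List (Fin n) → ℤ
  completions σ S L = ∑ (𝔖 n) (λ w → 𝟙 (agreeOff? σ S w) * ∏ L (local w))

  -- Agreement off `S` makes the provisional closure genuine, so the list is the full orbit of `v`
  -- under `w`. The explicit `b` keeps the cycle nontrivial.
  closedCycle : ∀ {σ v a b P} {S : Vec (Fin n) k} → OpenCycle σ v a (b ∷ P) S →
    ∀ {w} → IsPerm w → AgreeOff σ S w →
    ∏ (a ∷ b ∷ P) (local w) ≡
    M a v * walkWeight M (a ∷ b ∷ P) - N a v * walkWeight N (a ∷ b ∷ P)
  closedCycle {σ = σ} {v} {a} {b} {P} o {w} perm agree = begin
    ∏ (a ∷ b ∷ P) (local w)
      ≡⟨ cong (λ L → ∏ L (local w)) L≡ ⟩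
    ∏ (orbit w v ℓ) (local w)
      ≡⟨ ∏-local-cycle perm v (length P) (subst List.Unique L≡ (unique o)) wℓv≡v
           (subst (ListAll.All (λ i → toℕ v ≤ toℕ i)) L≡ (least o)) ⟩
    ∏ (orbit w v ℓ) (λ i → M i (ap w i)) - ∏ (orbit w v ℓ) (λ i → N i (ap w i))
      ≡⟨ cong₂ _-_ (closing M) (closing N) ⟨
    M a v * walkWeight M (a ∷ b ∷ P) - N a v * walkWeight N (a ∷ b ∷ P) ∎
    where
    ℓ = suc (suc (length P))
    w≈σ : ∀ {i} → i ∈ a ∷ b ∷ P → σ i ≡ ap w i
    w≈σ {i} i∈ = sym (agree i (disjoint o i∈))
    L≡ : a ∷ b ∷ P ≡ orbit w v ℓ
    L≡ = walk-orbit w (walk-cong (w≈σ ∘ there) (walk o))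
    wℓv≡v : iter w ℓ v ≡ v
    wℓv≡v = trans (cong (ap w) (sym (∷-injectiveˡ L≡))) (trans (sym (w≈σ (here refl))) (closes o))
    closing : ∀ (K : Fin n → Fin n → ℤ) →
      K a v * walkWeight K (a ∷ b ∷ P) ≡ ∏ (orbit w v ℓ) (λ i → K i (ap w i))
    closing K = trans (cong₂ _*_ (cong₂ K (∷-injectiveˡ L≡) (sym wℓv≡v)) (cong (walkWeight K) L≡))
      (walkWeight-orbit K w v (suc (length P)))

  sum-close : ∀ {σ v a b P} {S : Vec (Fin n) k} → OpenCycle σ v a (b ∷ P) S →
    completions σ S (toList S) ≡ h S →
    ∑ (𝔖 n) (λ w → 𝟙 (agreeOff? σ S w) * (∏ (a ∷ b ∷ P) (local w) * ∏ (toList S) (local w))) ≡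
    walkWeight M (a ∷ b ∷ P) * (M a v * h S) - walkWeight N (a ∷ b ∷ P) * (N a v * h S)
  sum-close {σ = σ} {v} {a} {b} {P} {S} o rest = begin
    ∑ (𝔖 n) (λ w → 𝟙 (agreeOff? σ S w) * (∏ L (local w) * ∏ (toList S) (local w)))
      ≡⟨ ∑-cong (𝔖 n) (λ {w} w∈ → trans
           (𝟙-*-cong (agreeOff? σ S w) (λ agree →
             cong (_* ∏ (toList S) (local w)) (closedCycle o (∈𝔖⇒IsPerm w∈) agree)))
           (*-swap (𝟙 (agreeOff? σ S w)) c (∏ (toList S) (local w)))) ⟩
    ∑ (𝔖 n) (λ w → c * (𝟙 (agreeOff? σ S w) * ∏ (toList S) (local w)))
      ≡⟨ ∑-*ˡ (𝔖 n) c _ ⟩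
    c * completions σ S (toList S)
      ≡⟨ cong (c *_) rest ⟩
    c * h S
      ≡⟨ lem (M a v) (walkWeight M L) (N a v) (walkWeight N L) (h S) ⟩
    walkWeight M L * (M a v * h S) - walkWeight N L * (N a v * h S) ∎
    where
    L = a ∷ b ∷ P
    c = M a v * walkWeight M L - N a v * walkWeight N L
    lem : ∀ m p m′ p′ r → (m * p - m′ * p′) * r ≡ p * (m * r) - p′ * (m′ * r)
    lem = solve-∀

  sum-closed : ∀ k σ (S : Vec (Fin n) k) → Injective _≡_ _≡_ σ → (∀ {s} → s Vec.∈ S → σ s ≡ s) →
    Sorted S → completions σ S (toList S) ≡ h S

  -- The stretch from `v` to `a` is decided and contributes `walkWeight`; `walks` runs over the ways
  -- to return to `v`. The two terms are kept apart because the final length, and with it the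
  -- relative sign, is still open.
  sum-open : ∀ k σ v a b P (S : Vec (Fin n) k) → OpenCycle σ v a (b ∷ P) S →
    ∑ (𝔖 n) (λ w → 𝟙 (agreeOff? σ (a ∷ S) w) * (∏ (a ∷ b ∷ P) (local w) * ∏ (toList S) (local w))) ≡
    walkWeight M (a ∷ b ∷ P) * walks M h v a S - walkWeight N (a ∷ b ∷ P) * walks N h v a S
  sum-open zero σ v a b P [] o = trans
    (split₀ o (λ w → ∏ (a ∷ b ∷ P) (local w) * 1ℤ))
    (sum-close o (sum-closed zero σ [] (injective o) (fixes o) (sorted o)))
  sum-open (suc k) σ v a b P S o = begin
    ∑ (𝔖 n) (λ w → 𝟙 (agreeOff? σ (a ∷ S) w) * f w)
      ≡⟨ split o f ⟩
    ∑ (𝔖 n) (λ w → 𝟙 (agreeOff? σ S w) * f w) +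
    ∑pick S (λ x T → ∑ (𝔖 n) (λ w → 𝟙 (agreeOff? (σ ∘ transpose a x) (x ∷ T) w) * f w))
      ≡⟨ cong₂ _+_ (sum-close o (sum-closed (suc k) σ S (injective o) (fixes o) (sorted o)))
           (trans (∑pick-cong S continue) (∑pick-- S _ _)) ⟩
    (p * (M a v * h S) - q * (N a v * h S)) +
    (∑pick S (λ x T → p * (M a x * walks M h v x T)) - ∑pick S (λ x T → q * (N a x * walks N h v x T)))
      ≡⟨ cong₂ (λ y z → (p * (M a v * h S) - q * (N a v * h S)) + (y - z))
           (∑pick-*ˡ S p (λ x T → M a x * walks M h v x T)) (∑pick-*ˡ S q (λ x T → N a x * walks N h v x T)) ⟩
    (p * (M a v * h S) - q * (N a v * h S)) + (p * Y - q * Z)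
      ≡⟨ lem p q (M a v * h S) (N a v * h S) Y Z ⟩
    p * walks M h v a S - q * walks N h v a S ∎
    where
    f : Vec (Fin n) n → ℤ
    f w = ∏ (a ∷ b ∷ P) (local w) * ∏ (toList S) (local w)
    p = walkWeight M (a ∷ b ∷ P)
    q = walkWeight N (a ∷ b ∷ P)
    Y = ∑pick S (λ x T → M a x * walks M h v x T)
    Z = ∑pick S (λ x T → N a x * walks N h v x T)
    lem : ∀ p q m m′ y z → (p * m - q * m′) + (p * y - q * z) ≡ p * (m + y) - q * (m′ + z)
    lem = solve-∀
    swap : ∀ a b c → a * (b * c) ≡ (b * a) * c
    swap = solve-∀
    rotate : ∀ a b c → a * b * c ≡ b * (a * c)
    rotate = solve-∀
    continue : ∀ {x T} → Pick x T S →
      ∑ (𝔖 n) (λ w → 𝟙 (agreeOff? (σ ∘ transpose a x) (x ∷ T) w) * f w) ≡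
      p * (M a x * walks M h v x T) - q * (N a x * walks N h v x T)
    continue {x} {T} pick = begin
      ∑ (𝔖 n) (λ w → 𝟙 (agreeOff? (σ ∘ transpose a x) (x ∷ T) w) * f w)
        ≡⟨ ∑-cong (𝔖 n) (λ {w} _ → cong (𝟙 (agreeOff? (σ ∘ transpose a x) (x ∷ T) w) *_)
             (trans (cong (∏ (a ∷ b ∷ P) (local w) *_) (∏-Pick pick (local w)))
               (swap (∏ (a ∷ b ∷ P) (local w)) (local w x) (∏ (toList T) (local w))))) ⟩
      ∑ (𝔖 n) (λ w → 𝟙 (agreeOff? (σ ∘ transpose a x) (x ∷ T) w) *
                     (∏ (x ∷ a ∷ b ∷ P) (local w) * ∏ (toList T) (local w)))
        ≡⟨ sum-open k (σ ∘ transpose a x) v x a (b ∷ P) T (extend o pick) ⟩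
      M a x * p * walks M h v x T - N a x * q * walks N h v x T
        ≡⟨ cong₂ _-_ (rotate (M a x) p (walks M h v x T)) (rotate (N a x) q (walks N h v x T)) ⟩
      p * (M a x * walks M h v x T) - q * (N a x * walks N h v x T) ∎

  singleton : ∀ {σ v} {S : Vec (Fin n) k} → Injective _≡_ _≡_ σ → (∀ {s} → s Vec.∈ (v ∷ S) → σ s ≡ s) →
    Sorted (v ∷ S) → OpenCycle σ v v [] S
  singleton inj fix (v< ∷ sorted) = record
    { injective = inj
    ; closes    = fix (here refl)
    ; walk      = start
    ; unique    = ListAll.[] ∷ []
    ; least     = ℕ.≤-refl ListAll.∷ ListAll.[]
    ; disjoint  = λ { (here refl) v∈S → Fin.<-irrefl refl (All.lookup v< v∈S) }
    ; fixes     = fix ∘ there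
    ; above     = v<
    ; sorted    = sorted
    }

  -- Closing at once makes `v` a fixed point with local factor 1, the counterpart of the separate
  -- summand in `ham-cons-tournament`.
  sum-fixed : ∀ {σ v} {S : Vec (Fin n) k} → OpenCycle σ v v [] S → completions σ S (toList S) ≡ h S →
    ∑ (𝔖 n) (λ w → 𝟙 (agreeOff? σ S w) * (local w v * ∏ (toList S) (local w))) ≡ h S
  sum-fixed {σ = σ} {v} {S} o rest = trans
    (∑-cong (𝔖 n) (λ {w} _ → 𝟙-*-cong (agreeOff? σ S w) (λ agree → trans
      (cong (_* ∏ (toList S) (local w)) (local-fixed w v (trans (agree v (a∉S o)) (closes o))))
      (*-identityˡ (∏ (toList S) (local w))))))
    rest

  -- The bare loop has weight 0 here, so the closed walks at `v` are exactly those that first move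
  -- to another vertex, as nontrivial cycles do.
  walks-loopless : ∀ v (S : Vec (Fin n) (suc k)) → walks M h v v S - walks N h v v S ≡
    ∑pick S (λ x T → M v x * walks M h v x T) - ∑pick S (λ x T → N v x * walks N h v x T)
  walks-loopless v S = trans
    (cong (λ z → (z * h S + Y) - ((- z) * h S + Z)) (A-loopless v)) (lem (h S) Y Z)
    where
    Y = ∑pick S (λ x T → M v x * walks M h v x T)
    Z = ∑pick S (λ x T → N v x * walks N h v x T)
    lem : ∀ p y z → (0ℤ * p + y) - ((- 0ℤ) * p + z) ≡ y - z
    lem = solve-∀

  sum-closed zero σ [] inj fix _ = trans
    (∑-cong (𝔖 n) (λ {w} _ → *-identityʳ (𝟙 (agreeOff? σ [] w)))) (∑-agree-everywhere inj)
  sum-closed (suc zero) σ (v ∷ []) inj fix s = trans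
    (split₀ (singleton inj fix s) (λ w → local w v * 1ℤ))
    (sum-fixed (singleton inj fix s) (sum-closed zero σ [] inj (λ ()) []))
  sum-closed (suc (suc k)) σ (v ∷ S) inj fix s@(_ ∷ sS) = begin
    ∑ (𝔖 n) (λ w → 𝟙 (agreeOff? σ (v ∷ S) w) * f w)
      ≡⟨ split o f ⟩
    ∑ (𝔖 n) (λ w → 𝟙 (agreeOff? σ S w) * f w) +
    ∑pick S (λ x T → ∑ (𝔖 n) (λ w → 𝟙 (agreeOff? (σ ∘ transpose v x) (x ∷ T) w) * f w))
      ≡⟨ cong₂ _+_ (sum-fixed o (sum-closed (suc k) σ S inj (fix ∘ there) sS))
           (trans (∑pick-cong S continue) (∑pick-- S _ _)) ⟩
    h S + (∑pick S (λ x T → M v x * walks M h v x T) - ∑pick S (λ x T → N v x * walks N h v x T))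
      ≡⟨ cong (h S +_) (walks-loopless v S) ⟨
    h S + (walks M h v v S - walks N h v v S)
      ≡⟨ ham-cons-tournament A A-loopless A-tournament v S (Sorted⇒Unique s) ⟨
    h (v ∷ S) ∎
    where
    o : OpenCycle σ v v [] S
    o = singleton inj fix s
    f : Vec (Fin n) n → ℤ
    f w = local w v * ∏ (toList S) (local w)
    swap : ∀ a b c → a * (b * c) ≡ (b * (a * 1ℤ)) * c
    swap = solve-∀
    continue : ∀ {x T} → Pick x T S →
      ∑ (𝔖 n) (λ w → 𝟙 (agreeOff? (σ ∘ transpose v x) (x ∷ T) w) * f w) ≡
      M v x * walks M h v x T - N v x * walks N h v x T
    continue {x} {T} pick = begin
      ∑ (𝔖 n) (λ w → 𝟙 (agreeOff? (σ ∘ transpose v x) (x ∷ T) w) * f w)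
        ≡⟨ ∑-cong (𝔖 n) (λ {w} _ → cong (𝟙 (agreeOff? (σ ∘ transpose v x) (x ∷ T) w) *_)
             (trans (cong (local w v *_) (∏-Pick pick (local w)))
               (swap (local w v) (local w x) (∏ (toList T) (local w))))) ⟩
      ∑ (𝔖 n) (λ w → 𝟙 (agreeOff? (σ ∘ transpose v x) (x ∷ T) w) *
                     (∏ (x ∷ v ∷ []) (local w) * ∏ (toList T) (local w)))
        ≡⟨ sum-open k (σ ∘ transpose v x) v x v [] T (extend o pick) ⟩
      M v x * 1ℤ * walks M h v x T - N v x * 1ℤ * walks N h v x T
        ≡⟨ cong₂ (λ y z → y * walks M h v x T - z * walks N h v x T)
             (*-identityʳ (M v x)) (*-identityʳ (N v x)) ⟩
      M v x * walks M h v x T - N v x * walks N h v x T ∎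

  good-ham : pos (sum (map (λ w → 2 ^ nsc w) (filter (good? X n) (𝔖 n)))) ≡ h (Vec.allFin n)
  good-ham = begin
    pos (sum (map (λ w → 2 ^ nsc w) (filter (good? X n) (𝔖 n))))
      ≡⟨ trans (pos-sum (λ w → 2 ^ nsc w) (filter (good? X n) (𝔖 n)))
           (∑-filter (good? X n) (𝔖 n) (λ w → pos (2 ^ nsc w))) ⟩
    ∑ (𝔖 n) (λ w → 𝟙 (good? X n w) * pos (2 ^ nsc w))
      -- Initially nothing is decided: agreement with `id` off the full vertex set is vacuous, so
      -- the indicator can be inserted for every `w`.
      ≡⟨ ∑-cong (𝔖 n) (λ {w} _ → trans (good-∏-local w) (sym (trans
           (cong₂ _*_ (𝟙-yes (agreeOff? id (Vec.allFin n) w)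
             (λ i i∉ → contradiction (Vec.∈-allFin⁺ i) i∉)) (cong (λ L → ∏ L (local w)) (toList-tabulate id)))
           (*-identityˡ (∏ (allFin n) (local w)))))) ⟩
    completions id (Vec.allFin n) (toList (Vec.allFin n))
      ≡⟨ sum-closed n id (Vec.allFin n) id (λ _ → refl) (Sorted-tabulate id id) ⟩
    h (Vec.allFin n) ∎

theorem3p3 : (X : Subset²) → (∀ (n : ℕ) → IsTournament (G X n)) →
    ∀ (n : ℕ) → dX∅ X n ≡ sum (map (λ w → 2 ^ nsc w) (filter (good? X n) (𝔖 n)))
theorem3p3 X tournament n = +-injective
  (trans (Edges.dX∅-ham X n) (sym (Count.good-ham X n (tournament n))))
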